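{- Let $\delta\geq 1$, $k\geq 0$, $h=k+1$ and $t\geq 1$ be integers, and let $n\geq 2$ and $m$ be integers with $2m\geq n\delta$. There is a graph $G$ of order $n$ with $m$ edges and minimum degree $\delta$ such that $\mathrm{sp}(G,k)=f_t(n,m,\delta,k)$ if and only if there is an integer $s$ with $$\frac{n}{t+1}\leq s\leq\frac{n}{t}\qquad\text{and}\qquad 2m=n(\delta+th)-\frac{s\,h\,t(t+1)}{2}$$ such that the sequence $P$ consisting of $s$ copies of each of $\delta,\delta+h,\ldots,\delta+(t-1)h$ and $n-ts$ copies of $\delta+th$ is graphic. Moreover, for an integer $s$ satisfying the two displayed conditions, $P$ is graphic whenever $$n\geq\frac{(2\delta+th+1)^2}{4\delta},$$ and, if $k=0$, $P$ is graphic if and only if $n$ exceeds the largest term of $P$.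
   Context: Graphs are finite and simple; a sequence of integers is graphic if it is the degree sequence of a graph. For a graph $G$ and $B\subseteq V(G)$ the spread is $\mathrm{sp}(B)=\max_{u\in B}\deg_G(u)-\min_{v\in B}\deg_G(v)$, and $\mathrm{sp}(G,k)$ is the largest cardinality of a set $B\subseteq V(G)$ with $\mathrm{sp}(B)\leq k$. Further, $$f_t(n,m,\delta,k)=\frac{2\left(n(\delta+t(k+1))-2m\right)}{(k+1)\,t(t+1)}.$$ -}

module Defs where

open import Data.Bool using (Bool; false; T; T?)
open import Data.Fin using (Fin; _<?_)
open import Data.Fin.Subset using (Subset; inside; outside; ∣_∣)
open import Data.Fin.Subset.Properties using (_∈?_)
open import Data.Integer as ℤ using (ℤ; +_)
open import Data.List using (List; []; _∷_; _++_; map; concatMap; filter; length; replicate; upTo; allFin; cartesianProduct)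
open import Data.List.Extrema.Nat using (max; min)
open import Data.List.Relation.Binary.Permutation.Propositional using (_↭_)
open import Data.Nat using (ℕ; zero; suc; _+_; _*_; _∸_; NonZero; _≤?_)
open import Data.Nat.Properties using (m*n≢0)
open import Data.Product using (_×_; _,_; Σ-syntax; ∃-syntax)
open import Data.Rational as ℚ using (ℚ; _/_)
import Data.Vec as Vec
open import Relation.Binary.PropositionalEquality using (_≡_)
open import Relation.Nullary.Decidable using (_×-dec_)

record Graph (n : ℕ) : Set where
  field
    adj     : Fin n → Fin n → Bool
    irrefl  : ∀ u → adj u u ≡ false
    adj-sym : ∀ u v → adj u v ≡ adj v u

open Graph public

-- The value 0 on the empty list is a convention only.
maximum : List ℕ → ℕ
maximum []       = 0
maximum (x ∷ xs) = max x xs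

minimum : List ℕ → ℕ
minimum []       = 0
minimum (x ∷ xs) = min x xs

subsets : ∀ n → List (Subset n)
subsets zero    = Vec.[] ∷ []
subsets (suc n) = map (inside Vec.∷_) (subsets n) ++ map (outside Vec.∷_) (subsets n)

module _ {n : ℕ} (G : Graph n) where

  neighbours : Fin n → Subset n
  neighbours u = Vec.tabulate (adj G u)

  deg : Fin n → ℕ
  deg u = ∣ neighbours u ∣

  degrees : List ℕ
  degrees = map deg (allFin n)

  minDegree : ℕ
  minDegree = minimum degrees

  -- Each edge {i , j} is represented by its unique pair (i , j) with i < j.
  edges : List (Fin n × Fin n)
  edges = filter (λ (i , j) → (i <? j) ×-dec T? (adj G i j))
                 (cartesianProduct (allFin n) (allFin n))

  size : ℕ
  size = length edges

  degreesIn : Subset n → List ℕ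
  degreesIn B = map deg (filter (_∈? B) (allFin n))

  spread : Subset n → ℕ
  spread B = maximum (degreesIn B) ∸ minimum (degreesIn B)

  -- The empty set gets spread 0, which does not affect this maximum:
  -- ∅ contributes cardinality 0.
  sp : ℕ → ℕ
  sp k = maximum (map ∣_∣ (filter (λ B → spread B ≤? k) (subsets n)))

-- A sequence is identified with its rearrangements.
Graphic : List ℕ → Set
Graphic ds = ∃[ n ] Σ[ G ∈ Graph n ] degrees G ↭ ds

-- The numerator may be negative, so its difference is taken in ℤ.
f : (t n m δ k : ℕ) → .{{NonZero t}} → ℚ
f t n m δ k =
  _/_ (+ 2 ℤ.* (+ (n * (δ + t * suc k)) ℤ.- + (2 * m)))
      (suc k * t * suc t)
      {{m*n≢0 (suc k * t) (suc t) {{m*n≢0 (suc k) t}}}}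

Admissible : (δ h t n m s : ℕ) → .{{NonZero t}} → Set
Admissible δ h t n m s =
  (+ n / suc t ℚ.≤ + s / 1) ×
  (+ s / 1 ℚ.≤ + n / t) ×
  (+ (2 * m) / 1 ≡ + (n * (δ + t * h)) / 1 ℚ.- + (s * h * t * suc t) / 2)

-- The truncated n ∸ t * s is the true difference whenever s ≤ n/t.
P : (δ h t n s : ℕ) → List ℕ
P δ h t n s =
  concatMap (λ i → replicate s (δ + i * h)) (upTo t) ++
  replicate (n ∸ t * s) (δ + t * h)

{-# OPTIONS --safe #-}
-- Cutting the degrees into windows [δ + jh , δ + jh + k] of at most sp(G, k) vertices each bounds 2m from below;
-- the bound reads sp(G, k) ≥ f_t, and equality forces every degree onto the bottom of its window and the first t
-- windows to be full, i.e. the degree sequence P. For graphicality the Erdős–Gallai inequalities suffice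
-- (Tripathi, Venugopalan and West: grow a graph below the prescribed degrees, satisfying the vertices in
-- decreasing order of degree; when no edge exchange helps, the inequality is attained). For P these
-- inequalities follow from AM-GM when n is large, and from a direct count of the terms above a threshold when k = 0.
module Submission where

open import Defs
open import Data.Bool using (Bool; true; false; not; if_then_else_; T?; _∧_)
open import Data.Bool.Properties using () renaming (_≟_ to _≟ᵇ_)
open import Data.Empty using (⊥; ⊥-elim)
open import Data.Fin using (Fin; zero; suc; toℕ; fromℕ<) renaming (_<?_ to _<ᶠ?_)
open import Data.Fin.Properties using (_≟_; any?; toℕ-injective; toℕ-fromℕ<; toℕ<n)
open import Data.Fin.Subset using (Subset; inside; outside; ∣_∣; _∈_)
open import Data.Fin.Subset.Properties using (_∈?_)
open import Data.List using (List; []; _∷_; _++_; map; filter; length; lookup; tabulate; replicate; allFin; upTo; concatMap; cartesianProduct)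
open import Data.List.Extrema.Nat using (max≤v⁺; v≤min⁺; xs≤max; ⊥≤max; min≤xs; min≤⊤)
import Data.List.Membership.Propositional as List
open import Data.List.Membership.Propositional.Properties using (∈-++⁺ˡ; ∈-++⁺ʳ; ∈-map⁺; ∈-filter⁺; ∈-allFin)
open import Data.List.Properties using (++-assoc; ++-identityʳ; concatMap-cong; concatMap-map; filter-++; filter-all; filter-none; length-++; length-filter; length-map; length-replicate; length-tabulate; map-++; map-tabulate; map-upTo; tabulate-cong; tabulate-lookup)
open import Data.List.Relation.Binary.Permutation.Propositional using (_↭_; ↭-refl; ↭-sym; ↭-trans; ↭-reflexive; prep)
open import Data.List.Relation.Binary.Permutation.Propositional.Properties using (↭-length; All-resp-↭; ∈-resp-↭; filter-↭; map⁺; shift; ++⁺)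
open import Data.List.Relation.Unary.All as All using (All; []; _∷_)
import Data.List.Relation.Unary.All.Properties as All
open import Data.List.Relation.Unary.Any using (here)
open import Data.List.Relation.Unary.Sorted.TotalOrder.Properties using (lookup-mono-≤)
open import Data.List.Sort using (sort; sort-↭; sort-↗)
open import Data.Nat using (ℕ; zero; suc; _+_; _*_; _∸_; _^_; _⊓_; _≤_; _<_; _≤?_; _<?_; z≤n; s≤s; s≤s⁻¹; NonZero; >-nonZero⁻¹)
open import Data.Nat.ListAction using (sum)
open import Data.Nat.ListAction.Properties using (sum-↭; sum-++)
open import Data.Nat.Properties hiding (_≟_)
open import Data.Nat.Tactic.RingSolver using (solve-∀)
open import Data.Product using (_×_; _,_; Σ-syntax; ∃-syntax; proj₁; proj₂)
open import Data.Sum using (_⊎_; inj₁; inj₂)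
import Data.Vec as Vec
open import Data.Vec.Properties using (lookup∘tabulate; []=⇒lookup)
open import Function using (_∘_; id)
open import Function.Bundles using (_⇔_; mk⇔)
open import Relation.Binary using (DecTotalOrder; tri<; tri≈; tri>)
import Relation.Binary.Construct.Flip.EqAndOrd as Flip
open import Relation.Binary.PropositionalEquality
open import Relation.Nullary using (¬_; Dec; yes; no; does; contradiction)
open import Relation.Nullary.Decidable using (_×-dec_; _⊎-dec_; ¬?; dec-true; dec-false)
open import Relation.Unary using (Decidable)
open import Algebra.Properties.Semiring.Sum +-*-semiring renaming (sum to ∑) hiding (sum-replicate)

-- Sums over Fin n and edge exchanges

-- Origin of f_t: credit every vertex with δ + th. A vertex in window j < t falls short of this by
-- at most (t - j)h, a vertex beyond these windows does not fall short, and a window holds at most σ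
-- = sp(G, k) vertices. Hence 2m ≥ n(δ + th) - σh(1 + ... + t), which rearranges to σ ≥ f_t for
-- every t. The range of s records that in the equality case the first t windows are full and the
-- remaining vertices fit into one more. The obstacle when k = 0 is that only n ≥ Δ + 1 is known,
-- with Δ the largest term. Replacing each chosen term by Δ and each other term by δ, which is
-- enough for large n, then loses too much, so the staircase shape of P has to enter on both sides
-- of the Erdős-Gallai inequality.

⟦_⟧ : Bool → ℕ
⟦ true  ⟧ = 1
⟦ false ⟧ = 0

∑-mono-≤ : ∀ {n} {f g : Fin n → ℕ} → (∀ i → f i ≤ g i) → ∑ f ≤ ∑ g
∑-mono-≤ {zero}  f≤g = z≤n
∑-mono-≤ {suc n} f≤g = +-mono-≤ (f≤g zero) (∑-mono-≤ (f≤g ∘ suc))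

∑-mono-< : ∀ {n} {f g : Fin n → ℕ} → (∀ i → f i ≤ g i) → ∀ x → f x < g x → ∑ f < ∑ g
∑-mono-< {suc n} f≤g zero    fx<gx = +-mono-<-≤ fx<gx (∑-mono-≤ (f≤g ∘ suc))
∑-mono-< {suc n} f≤g (suc x) fx<gx = +-mono-≤-< (f≤g zero) (∑-mono-< (f≤g ∘ suc) x fx<gx)

-- Subtraction-free bookkeeping for a change in one coordinate: each total is completed by the other
-- function's value at `y`.
∑-update : ∀ {n} {f g : Fin n → ℕ} y → (∀ i → i ≢ y → f i ≡ g i) → ∑ f + g y ≡ ∑ g + f y
∑-update {suc n} {f} {g} zero f≗g = begin
  f zero + ∑ (f ∘ suc) + g zero  ≡⟨ cong (λ z → f zero + z + g zero) (sum-cong-≗ λ i → f≗g (suc i) λ ()) ⟩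
  f zero + ∑ (g ∘ suc) + g zero  ≡⟨ rearrange (f zero) _ _ ⟩
  g zero + ∑ (g ∘ suc) + f zero  ∎
  where
  open ≡-Reasoning
  rearrange : ∀ a b c → a + b + c ≡ c + b + a
  rearrange = solve-∀
∑-update {suc n} {f} {g} (suc y) f≗g = begin
  f zero + ∑ (f ∘ suc) + g (suc y)    ≡⟨ +-assoc (f zero) _ _ ⟩
  f zero + (∑ (f ∘ suc) + g (suc y))  ≡⟨ cong₂ _+_ (f≗g zero λ ())
                                          (∑-update y λ i i≢y → f≗g (suc i) λ { refl → i≢y refl }) ⟩
  g zero + (∑ (g ∘ suc) + f (suc y))  ≡⟨ +-assoc (g zero) _ _ ⟨
  g zero + ∑ (g ∘ suc) + f (suc y)    ∎
  where open ≡-Reasoning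

-- Kronecker delta at `x`; changes of degree are written as sums of these.
e : ∀ {n} → Fin n → Fin n → ℕ
e x u = ⟦ does (u ≟ x) ⟧

e-refl : ∀ {n} (x : Fin n) → e x x ≡ 1
e-refl x = cong ⟦_⟧ (dec-true (x ≟ x) refl)

e-≢ : ∀ {n} {x u : Fin n} → u ≢ x → e x u ≡ 0
e-≢ {x = x} {u} u≢x = cong ⟦_⟧ (dec-false (u ≟ x) u≢x)

∑-e : ∀ {n} (f : Fin n → ℕ) x → ∑ (λ u → f u * e x u) ≡ f x
∑-e {n} f x = begin
  ∑ (λ u → f u * e x u)      ≡⟨ +-identityʳ _ ⟨
  ∑ (λ u → f u * e x u) + 0  ≡⟨ ∑-update {g = λ _ → 0} x (λ u u≢x → trans (cong (f u *_) (e-≢ u≢x)) (*-zeroʳ (f u))) ⟩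
  ∑ {n} (λ _ → 0) + f x * e x x  ≡⟨ cong₂ _+_ (sum-replicate-zero n) (trans (cong (f x *_) (e-refl x)) (*-identityʳ (f x))) ⟩
  f x                        ∎
  where open ≡-Reasoning

∣tabulate∣ : ∀ {n} (b : Fin n → Bool) → ∣ Vec.tabulate b ∣ ≡ ∑ (⟦_⟧ ∘ b)
∣tabulate∣ {zero}  b = refl
∣tabulate∣ {suc n} b with b zero
... | true  = cong suc (∣tabulate∣ (b ∘ suc))
... | false = ∣tabulate∣ (b ∘ suc)

module _ {n} (G : Graph n) where

  A : Fin n → Fin n → ℕ
  A u v = ⟦ adj G u v ⟧

  deg≡∑ : ∀ u → deg G u ≡ ∑ (A u)
  deg≡∑ u = ∣tabulate∣ (adj G u)

Joins : ∀ {n} → Fin n → Fin n → Fin n → Fin n → Set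
Joins x y u v = (u ≡ x × v ≡ y) ⊎ (u ≡ y × v ≡ x)

joins? : ∀ {n} (x y u v : Fin n) → Dec (Joins x y u v)
joins? x y u v = (u ≟ x ×-dec v ≟ y) ⊎-dec (u ≟ y ×-dec v ≟ x)

joins-sym : ∀ {n} {x y u v : Fin n} → Joins x y u v → Joins x y v u
joins-sym (inj₁ (p , q)) = inj₂ (q , p)
joins-sym (inj₂ (p , q)) = inj₁ (q , p)

module _ {n} (G : Graph n) {x y : Fin n} (x≢y : x ≢ y) (b : Bool) where

  private
    adj′ : Fin n → Fin n → Bool
    adj′ u v = if does (joins? x y u v) then b else adj G u v

    hit : ∀ {u v} → Joins x y u v → adj′ u v ≡ b
    hit {u} {v} j = cong (if_then b else adj G u v) (dec-true (joins? x y u v) j)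

    miss : ∀ {u v} → ¬ Joins x y u v → adj′ u v ≡ adj G u v
    miss {u} {v} ¬j = cong (if_then b else adj G u v) (dec-false (joins? x y u v) ¬j)

  setEdge : Graph n
  setEdge .adj = adj′
  setEdge .irrefl u = trans (miss λ { (inj₁ (p , q)) → x≢y (trans (sym p) q)
                                    ; (inj₂ (p , q)) → x≢y (trans (sym q) p) }) (irrefl G u)
  setEdge .adj-sym u v = aux (joins? x y v u)
    where
    aux : Dec (Joins x y v u) → adj′ u v ≡ adj′ v u
    aux (yes j) = trans (hit (joins-sym j)) (sym (hit j))
    aux (no ¬j) = trans (miss (¬j ∘ joins-sym)) (trans (adj-sym G u v) (sym (miss ¬j)))

  setEdge-other : ∀ {u v} → ¬ Joins x y u v → adj setEdge u v ≡ adj G u v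
  setEdge-other = miss

  -- The old and the new value of the pair stand on opposite sides, so one identity covers
  -- insertion, deletion and no change without subtraction.
  setEdge-deg : ∀ u → deg setEdge u + A G x y * (e x u + e y u) ≡ deg G u + ⟦ b ⟧ * (e x u + e y u)
  setEdge-deg u = subst₂ (λ p q → p + A G x y * (e x u + e y u) ≡ q + ⟦ b ⟧ * (e x u + e y u))
     (sym (deg≡∑ setEdge u)) (sym (deg≡∑ G u)) (go (u ≟ x) (u ≟ y))
    where
    change : ∀ {v} → Joins x y u v → e x u + e y u ≡ 1 → (∀ i → i ≢ v → ¬ Joins x y u i) → A G u v ≡ A G x y →
             ∑ (A setEdge u) + A G x y * (e x u + e y u) ≡ ∑ (A G u) + ⟦ b ⟧ * (e x u + e y u)
    change {v} j e≡1 off Auv rewrite e≡1 | *-identityʳ (A G x y) | *-identityʳ ⟦ b ⟧ = begin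
      ∑ (A setEdge u) + A G x y    ≡⟨ cong (_ +_) Auv ⟨
      ∑ (A setEdge u) + A G u v    ≡⟨ ∑-update v (λ i i≢v → cong ⟦_⟧ (miss (off i i≢v))) ⟩
      ∑ (A G u) + A setEdge u v    ≡⟨ cong (λ z → _ + ⟦ z ⟧) (hit j) ⟩
      ∑ (A G u) + ⟦ b ⟧            ∎
      where open ≡-Reasoning

    go : Dec (u ≡ x) → Dec (u ≡ y) →
         ∑ (A setEdge u) + A G x y * (e x u + e y u) ≡ ∑ (A G u) + ⟦ b ⟧ * (e x u + e y u)
    go (yes refl) _ = change (inj₁ (refl , refl)) (cong₂ _+_ (e-refl x) (e-≢ x≢y))
      (λ { i i≢v (inj₁ (_ , q)) → i≢v q ; i i≢v (inj₂ (p , _)) → x≢y p }) refl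
    go (no _) (yes refl) = change (inj₂ (refl , refl)) (cong₂ _+_ (e-≢ (x≢y ∘ sym)) (e-refl y))
      (λ { i i≢v (inj₁ (p , _)) → x≢y (sym p) ; i i≢v (inj₂ (_ , q)) → i≢v q }) (cong ⟦_⟧ (adj-sym G y x))
    go (no u≢x) (no u≢y) rewrite e-≢ u≢x | e-≢ u≢y | *-zeroʳ (A G x y) | *-zeroʳ ⟦ b ⟧ =
      cong (_+ 0) (sum-cong-≗ λ v → cong ⟦_⟧ (miss {u} {v} λ { (inj₁ (p , _)) → u≢x p ; (inj₂ (p , _)) → u≢y p }))

adj⇒≢ : ∀ {n} (G : Graph n) {u v} → adj G u v ≡ true → u ≢ v
adj⇒≢ G {u} uv refl = contradiction (trans (sym uv) (irrefl G u)) λ ()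

addEdge : ∀ {n} (G : Graph n) {x y : Fin n} → x ≢ y → adj G x y ≡ false →
          Σ[ G′ ∈ Graph n ] (∀ u → deg G′ u ≡ deg G u + (e x u + e y u)) ×
                            (∀ {u v} → ¬ Joins x y u v → adj G′ u v ≡ adj G u v)
addEdge G {x} {y} x≢y xy = setEdge G x≢y true , degs , setEdge-other G x≢y true
  where
  degs : ∀ u → deg (setEdge G x≢y true) u ≡ deg G u + (e x u + e y u)
  degs u with eq ← setEdge-deg G x≢y true u rewrite xy | +-identityʳ (e x u + e y u) = trans (sym (+-identityʳ _)) eq

-- Replaces the edge `cx` by `cy`: one unit of degree passes from `x` to `y`, while `c` loses one
-- edge and gains one.
moveEdge : ∀ {n} (G : Graph n) {c x y : Fin n} → x ≢ y → c ≢ y → adj G c x ≡ true → adj G c y ≡ false →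
           Σ[ G′ ∈ Graph n ] (∀ u → deg G′ u + e x u ≡ deg G u + e y u) ×
                             (∀ {u v} → ¬ Joins c x u v → ¬ Joins c y u v → adj G′ u v ≡ adj G u v)
moveEdge {n} G {c} {x} {y} x≢y c≢y cx cy = proj₁ added , degs , same
  where
  c≢x : c ≢ x
  c≢x = adj⇒≢ G cx

  G₁ : Graph n
  G₁ = setEdge G c≢x false

  added = addEdge G₁ {c} {y} c≢y
    (trans (setEdge-other G c≢x false (λ { (inj₁ (_ , q)) → x≢y (sym q) ; (inj₂ (p , _)) → c≢x p })) cy)

  degs : ∀ u → deg (proj₁ added) u + e x u ≡ deg G u + e y u
  degs u with eq ← setEdge-deg G c≢x false u rewrite cx | proj₁ (proj₂ added) u = begin
    deg G₁ u + (e c u + e y u) + e x u        ≡⟨ rearrange (deg G₁ u) (e c u) (e y u) (e x u) ⟩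
    deg G₁ u + ((e c u + e x u) + 0) + e y u  ≡⟨ cong (_+ e y u) eq ⟩
    deg G u + 0 + e y u                       ≡⟨ cong (_+ e y u) (+-identityʳ _) ⟩
    deg G u + e y u                           ∎
    where
    open ≡-Reasoning
    rearrange : ∀ a b c d → a + (b + c) + d ≡ a + ((b + d) + 0) + c
    rearrange = solve-∀

  same : ∀ {u v} → ¬ Joins c x u v → ¬ Joins c y u v → adj (proj₁ added) u v ≡ adj G u v
  same ¬cx ¬cy = trans (proj₂ (proj₂ added) ¬cy) (setEdge-other G c≢x false ¬cx)

-- Counting edges: the handshake identity.

length-filter-tabulate : ∀ {a} {X : Set a} {Q : X → Set} (Q? : Decidable Q) {n} (g : Fin n → X) →
                         length (filter Q? (tabulate g)) ≡ ∑ (λ i → ⟦ does (Q? (g i)) ⟧)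
length-filter-tabulate Q? {zero}  g = refl
length-filter-tabulate Q? {suc n} g with does (Q? (g zero))
... | true  = cong suc (length-filter-tabulate Q? (g ∘ suc))
... | false = length-filter-tabulate Q? (g ∘ suc)

length-filter-cartesianProduct :
  ∀ {a b} {X : Set a} {Y : Set b} {Q : X × Y → Set} (Q? : Decidable Q)
    {m n} (g : Fin m → X) (h : Fin n → Y) →
  length (filter Q? (cartesianProduct (tabulate g) (tabulate h))) ≡ ∑ (λ i → ∑ (λ j → ⟦ does (Q? (g i , h j)) ⟧))
length-filter-cartesianProduct Q? {zero}  g h = refl
length-filter-cartesianProduct Q? {suc m} g h = begin
  length (filter Q? (row ++ rows))               ≡⟨ cong length (filter-++ Q? row rows) ⟩
  length (filter Q? row ++ filter Q? rows)       ≡⟨ length-++ (filter Q? row) ⟩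
  length (filter Q? row) + length (filter Q? rows)
    ≡⟨ cong₂ _+_ (trans (cong (length ∘ filter Q?) (map-tabulate h (g zero ,_))) (length-filter-tabulate Q? ((g zero ,_) ∘ h)))
                 (length-filter-cartesianProduct Q? (g ∘ suc) h) ⟩
  ∑ (λ i → ∑ (λ j → ⟦ does (Q? (g i , h j)) ⟧))  ∎
  where
  open ≡-Reasoning
  row  = map (g zero ,_) (tabulate h)
  rows = cartesianProduct (tabulate (g ∘ suc)) (tabulate h)

sum-tabulate : ∀ {n} (g : Fin n → ℕ) → sum (tabulate g) ≡ ∑ g
sum-tabulate {zero}  g = refl
sum-tabulate {suc n} g = cong (g zero +_) (sum-tabulate (g ∘ suc))

-- `size` counts only pairs with i < j, so the adjacency matrix is split into its strict upper
-- triangle `U` and the transpose; the diagonal vanishes.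
∑-deg : ∀ {n} (G : Graph n) → ∑ (deg G) ≡ 2 * size G
∑-deg {n} G = begin
  ∑ (deg G)                                    ≡⟨ sum-cong-≗ (deg≡∑ G) ⟩
  ∑ (λ i → ∑ (λ j → A G i j))                  ≡⟨ sum-cong-≗ (λ i → sum-cong-≗ (λ j → split i j)) ⟩
  ∑ (λ i → ∑ (λ j → U i j + U j i))            ≡⟨ sum-cong-≗ (λ i → ∑-distrib-+ (U i) (λ j → U j i)) ⟩
  ∑ (λ i → ∑ (λ j → U i j) + ∑ (λ j → U j i))  ≡⟨ ∑-distrib-+ (λ i → ∑ (U i)) (λ i → ∑ (λ j → U j i)) ⟩
  ∑∑U + ∑ (λ i → ∑ (λ j → U j i))              ≡⟨ cong (∑∑U +_) (∑-comm U) ⟨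
  ∑∑U + ∑∑U                                    ≡⟨ cong (∑∑U +_) (+-identityʳ _) ⟨
  2 * ∑∑U                                      ≡⟨ cong (2 *_) (length-filter-cartesianProduct edge? id id) ⟨
  2 * size G                                   ∎
  where
  open ≡-Reasoning
  edge? : Decidable {A = Fin n × Fin n} _
  edge? (i , j) = (i <ᶠ? j) ×-dec T? (adj G i j)

  U : Fin n → Fin n → ℕ
  U i j = ⟦ does (edge? (i , j)) ⟧

  ∑∑U = ∑ (λ i → ∑ (U i))

  U-< : ∀ i j → toℕ i < toℕ j → U i j ≡ A G i j
  U-< i j i<j = cong (λ z → ⟦ z ∧ adj G i j ⟧) (dec-true (i <ᶠ? j) i<j)

  U-≮ : ∀ i j → ¬ toℕ i < toℕ j → U i j ≡ 0
  U-≮ i j i≮j = cong (λ z → ⟦ z ∧ adj G i j ⟧) (dec-false (i <ᶠ? j) i≮j)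

  split : ∀ i j → A G i j ≡ U i j + U j i
  split i j with <-cmp (toℕ i) (toℕ j)
  ... | tri< i<j _ j≮i rewrite U-< i j i<j | U-≮ j i j≮i = sym (+-identityʳ _)
  ... | tri> i≮j _ j<i rewrite U-< j i j<i | U-≮ i j i≮j = cong ⟦_⟧ (adj-sym G i j)
  ... | tri≈ i≮j i≡j j≮i rewrite U-≮ i j i≮j | U-≮ j i j≮i | toℕ-injective i≡j = cong ⟦_⟧ (irrefl G j)

handshake : ∀ {n} (G : Graph n) → sum (degrees G) ≡ 2 * size G
handshake G = trans (cong sum (map-tabulate id (deg G))) (trans (sum-tabulate (deg G)) (∑-deg G))

-- The Erdős–Gallai criterion

member : ∀ {n} → (Fin n → Bool) → Fin n → ℕ
member S i = ⟦ S i ⟧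

nonmember : ∀ {n} → (Fin n → Bool) → Fin n → ℕ
nonmember S i = ⟦ not (S i) ⟧

-- Equality in the Erdős–Gallai inequality, when S is a clique and its complement is independent.
split-degree-sum : ∀ {n} (G : Graph n) (S : Fin n → Bool) →
  (∀ i j → S i ≡ true → S j ≡ true → i ≢ j → adj G i j ≡ true) →
  (∀ i j → S i ≡ false → S j ≡ false → adj G i j ≡ false) →
  ∑ (λ i → member S i * deg G i) + ∑ (member S) ≡
  ∑ (member S) * ∑ (member S) + ∑ (λ j → nonmember S j * deg G j)
split-degree-sum {n} G S clique independent = begin
  ∑ (λ i → s i * deg G i) + ∑ s
    ≡⟨ ∑-distrib-+ (λ i → s i * deg G i) s ⟨
  ∑ (λ i → s i * deg G i + s i)
    ≡⟨ sum-cong-≗ (λ i → cong₂ _+_ (trans (cong (s i *_) (deg≡∑ G i)) (*-distribˡ-sum (s i) (A G i)))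
                                   (sym (∑-e (λ _ → s i) i))) ⟩
  ∑ (λ i → ∑ (λ j → s i * A G i j) + ∑ (λ j → s i * e i j))
    ≡⟨ sum-cong-≗ (λ i → ∑-distrib-+ (λ j → s i * A G i j) (λ j → s i * e i j)) ⟨
  ∑ (λ i → ∑ (λ j → s i * A G i j + s i * e i j))
    ≡⟨ sum-cong-≗ (λ i → sum-cong-≗ (λ j → pointwise i j)) ⟩
  ∑ (λ i → ∑ (λ j → s i * s j + c j * A G j i))
    ≡⟨ sum-cong-≗ (λ i → ∑-distrib-+ (λ j → s i * s j) (λ j → c j * A G j i)) ⟩
  ∑ (λ i → ∑ (λ j → s i * s j) + ∑ (λ j → c j * A G j i))
    ≡⟨ ∑-distrib-+ (λ i → ∑ (λ j → s i * s j)) (λ i → ∑ (λ j → c j * A G j i)) ⟩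
  ∑ (λ i → ∑ (λ j → s i * s j)) + ∑ (λ i → ∑ (λ j → c j * A G j i))
    ≡⟨ cong₂ _+_ (trans (sum-cong-≗ λ i → sym (*-distribˡ-sum (s i) s)) (sym (*-distribʳ-sum (∑ s) s)))
                 (∑-comm (λ i j → c j * A G j i)) ⟩
  ∑ s * ∑ s + ∑ (λ j → ∑ (λ i → c j * A G j i))
    ≡⟨ cong (∑ s * ∑ s +_) (sum-cong-≗ λ j →
         trans (sym (*-distribˡ-sum (c j) (A G j))) (cong (c j *_) (sym (deg≡∑ G j)))) ⟩
  ∑ s * ∑ s + ∑ (λ j → c j * deg G j) ∎
  where
  open ≡-Reasoning
  s = member S
  c = nonmember S

  distinct : ∀ {i j} → S i ≢ S j → e i j ≡ 0
  distinct {i} {j} Si≢Sj = e-≢ {x = i} {j} λ { refl → Si≢Sj refl }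

  -- The term with `e` fills the zero diagonal of the clique block. Mixed entries agree by symmetry,
  -- and the block outside `S` is zero by independence.
  pointwise : ∀ i j → s i * A G i j + s i * e i j ≡ s i * s j + c j * A G j i
  pointwise i j with S i in p | S j in q
  ... | true | true with j ≟ i
  ...   | yes refl rewrite irrefl G i = refl
  ...   | no j≢i rewrite clique i j p q (j≢i ∘ sym) = refl
  pointwise i j | true | false rewrite distinct {i} {j} (λ z → contradiction (trans (sym p) (trans z q)) λ ()) | adj-sym G i j =
    +-identityʳ _
  pointwise i j | false | true = refl
  pointwise i j | false | false rewrite independent j i q p = refl

-- Growing a realization: sufficiency of the inequalities.

≢false⇒≡true : ∀ {b} → b ≢ false → b ≡ true
≢false⇒≡true {true}  _ = refl
≢false⇒≡true {false} b = contradiction refl b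

⟦⟧-mono : ∀ {a b} → (a ≡ true → b ≡ true) → ⟦ a ⟧ ≤ ⟦ b ⟧
⟦⟧-mono {false} _ = z≤n
⟦⟧-mono {true}  f rewrite f refl = ≤-refl

-- Otherwise every neighbour of `i` other than `r` is also a neighbour of `r`, which would give deg
-- i ≤ deg r.
private-neighbour : ∀ {n} (G : Graph n) {i r} → deg G r < deg G i →
                    ∃[ u ] u ≢ r × adj G u i ≡ true × adj G u r ≡ false
private-neighbour {n} G {i} {r} r<i
  with any? (λ u → ¬? (u ≟ r) ×-dec (adj G u i ≟ᵇ true) ×-dec (adj G u r ≟ᵇ false))
... | yes found = found
... | no none = contradiction r<i (≤⇒≯ (+-cancelʳ-≤ (A G i r) _ _ bound))
  where
  open ≤-Reasoning
  -- If `i` and `r` are adjacent, the two rows differ at the columns `i` and `r` themselves. Adding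
  -- `A G i r` at the diagonal entry of each row makes these columns agree, and the same amount
  -- cancels from both totals.
  pointwise : ∀ u → A G i u + A G i r * e i u ≤ A G r u + A G i r * e r u
  pointwise u with u ≟ r | u ≟ i
  ... | yes refl | yes refl = ≤-refl
  ... | yes refl | no  _    rewrite irrefl G u = ≤-reflexive (arith (A G i u))
    where arith : ∀ a → a + a * 0 ≡ 0 + a * 1
          arith = solve-∀
  ... | no u≢r   | yes refl rewrite irrefl G u | adj-sym G u r = ≤-reflexive (arith (A G r u))
    where arith : ∀ a → 0 + a * 1 ≡ a + a * 0
          arith = solve-∀
  ... | no u≢r   | no  _    = +-monoˡ-≤ _ (⟦⟧-mono λ iu → ≢false⇒≡true λ ru →
          none (u , u≢r , trans (adj-sym G u i) iu , trans (adj-sym G u r) ru))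

  ∑-row : ∀ x → ∑ (λ u → A G x u + A G i r * e x u) ≡ deg G x + A G i r
  ∑-row x = trans (∑-distrib-+ (A G x) (λ u → A G i r * e x u))
                  (cong₂ _+_ (sym (deg≡∑ G x)) (∑-e (λ _ → A G i r) x))

  bound : deg G i + A G i r ≤ deg G r + A G i r
  bound = begin
    deg G i + A G i r                       ≡⟨ ∑-row i ⟨
    ∑ (λ u → A G i u + A G i r * e i u)     ≤⟨ ∑-mono-≤ pointwise ⟩
    ∑ (λ u → A G r u + A G i r * e r u)     ≡⟨ ∑-row r ⟩
    deg G r + A G i r                       ∎

missing-neighbour : ∀ {n} (G : Graph n) (S : Fin n → Bool) k → deg G k < ∑ (member S) →
                    ∃[ i ] S i ≡ true × adj G k i ≡ false
missing-neighbour G S k k<S with any? (λ i → (S i ≟ᵇ true) ×-dec (adj G k i ≟ᵇ false))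
... | yes found = found
... | no none = contradiction k<S (≤⇒≯ (subst (∑ (member S) ≤_) (sym (deg≡∑ G k))
                  (∑-mono-≤ λ i → ⟦⟧-mono λ Si → ≢false⇒≡true λ ki → none (i , Si , ki))))

-- The invariant of the growth. The vertex `r` in progress is exempt from both `tight` and `indep`:
-- it may be deficient, and it may have neighbours among the later vertices. At stage `n` the graph
-- realizes `d`.
record Subrealization {n} (d : Fin n → ℕ) (r : ℕ) (G : Graph n) : Set where
  field
    below : ∀ i → deg G i ≤ d i
    tight : ∀ i → toℕ i < r → deg G i ≡ d i
    indep : ∀ i j → r < toℕ i → r < toℕ j → adj G i j ≡ false

-- With p the size of `S`, this is the classical bound by p(p - 1) plus the sum of min(d, p). Taking
-- all sets of positions instead of initial segments makes it independent of the order, so it can be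
-- verified on an unsorted list.
ErdősGallai : ∀ {n} → (Fin n → ℕ) → Set
ErdősGallai {n} d = ∀ (S : Fin n → Bool) →
  ∑ (λ i → member S i * d i) + ∑ (member S) ≤
  ∑ (member S) * ∑ (member S) + ∑ (λ j → nonmember S j * (d j ⊓ ∑ (member S)))

module _ {n} (d : Fin n → ℕ) (antitone : ∀ i j → toℕ i ≤ toℕ j → d j ≤ d i)
         (half : ℕ) (even : ∑ d ≡ 2 * half) (erdősGallai : ErdősGallai d) (r : Fin n) where

  open Subrealization

  Raised : Graph n → Set
  Raised G = Σ[ G′ ∈ Graph n ] Subrealization d (toℕ r) G′ × deg G r < deg G′ r

  module _ (G : Graph n) (sub : Subrealization d (toℕ r) G) (deficient : deg G r < d r) where

    -- Every edge change below has an endpoint that is not after `r`; pairs of later vertices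
    -- therefore keep their status, and `indep` survives.
    untouched : ∀ {x y i j : Fin n} → toℕ y ≤ toℕ r → toℕ r < toℕ i → toℕ r < toℕ j → ¬ Joins x y i j
    untouched y≤r r<i r<j (inj₁ (_ , refl)) = <⇒≱ r<j y≤r
    untouched y≤r r<i r<j (inj₂ (refl , _)) = <⇒≱ r<i y≤r

    r<k : ∀ {k} → k ≢ r → deg G k < d k → toℕ r < toℕ k
    r<k {k} k≢r k<d with <-cmp (toℕ k) (toℕ r)
    ... | tri< k<r _ _ = contradiction (tight sub k k<r) (<⇒≢ k<d)
    ... | tri≈ _ k≡r _ = contradiction (toℕ-injective k≡r) k≢r
    ... | tri> _ _ r<k = r<k

    -- The use of the decreasing order: a finished vertex has degree d i ≥ d r > deg r, hence by
    -- `private-neighbour` an edge that can be redirected to `r`.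
    earlier-higher : ∀ {i} → toℕ i < toℕ r → deg G r < deg G i
    earlier-higher {i} i<r =
      <-≤-trans deficient (≤-trans (antitone i r (<⇒≤ i<r)) (≤-reflexive (sym (tight sub i i<r))))

    -- `k` may be `r` itself, which then gains two. Finished vertices stay exact, because degrees
    -- only grow and remain at most `d`.
    raise-pair : ∀ k (G′ : Graph n) → (∀ x → deg G′ x ≡ deg G x + (e r x + e k x)) →
                 (∀ x → deg G x + (e r x + e k x) ≤ d x) →
                 (∀ i j → toℕ r < toℕ i → toℕ r < toℕ j → adj G′ i j ≡ false) → Raised G
    raise-pair k G′ degs fits indep′ = G′ , sub′ , r-up
      where
      sub′ : Subrealization d (toℕ r) G′
      sub′ .below x = subst (_≤ d x) (sym (degs x)) (fits x)
      sub′ .tight x x<r = ≤-antisym (sub′ .below x)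
        (subst₂ _≤_ (tight sub x x<r) (sym (degs x)) (m≤m+n (deg G x) _))
      sub′ .indep = indep′
      r-up : deg G r < deg G′ r
      r-up rewrite degs r | e-refl r = m<m+n (deg G r) (s≤s z≤n)

    -- Lowering a later vertex `w` is harmless: `Subrealization` bounds its degree only from above.
    raise-from : ∀ w → toℕ r < toℕ w → (G′ : Graph n) → (∀ x → deg G′ x + e w x ≡ deg G x + e r x) →
                 (∀ i j → toℕ r < toℕ i → toℕ r < toℕ j → adj G′ i j ≡ false) → Raised G
    raise-from w r<w G′ degs indep′ = G′ , sub′ , ≤-reflexive (sym deg-r)
      where
      r≢w : r ≢ w
      r≢w refl = <-irrefl refl r<w

      deg-r : deg G′ r ≡ suc (deg G r)
      deg-r with eq ← degs r rewrite e-refl r | e-≢ {x = w} {r} r≢w =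
        trans (sym (+-identityʳ _)) (trans eq (+-comm _ 1))

      sub′ : Subrealization d (toℕ r) G′
      sub′ .below x with x ≟ r
      ... | yes refl = subst (_≤ d r) (sym deg-r) deficient
      ... | no x≢r with eq ← degs x rewrite e-≢ x≢r | +-identityʳ (deg G x) =
        ≤-trans (m≤m+n _ _) (≤-trans (≤-reflexive eq) (below sub x))
      sub′ .tight x x<r = begin
        deg G′ x          ≡⟨ +-identityʳ _ ⟨
        deg G′ x + 0      ≡⟨ cong (deg G′ x +_) (e-≢ {x = w} {x} λ { refl → <-asym r<w x<r }) ⟨
        deg G′ x + e w x  ≡⟨ degs x ⟩
        deg G x + e r x   ≡⟨ cong (deg G x +_) (e-≢ {x = r} {x} λ { refl → <-irrefl refl x<r }) ⟩
        deg G x + 0       ≡⟨ +-identityʳ _ ⟩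
        deg G x           ≡⟨ tight sub x x<r ⟩
        d x               ∎
        where open ≡-Reasoning
      sub′ .indep = indep′

    fits-pair : ∀ {k} → k ≢ r → deg G k < d k → ∀ x → deg G x + (e r x + e k x) ≤ d x
    fits-pair {k} k≢r k<d x with x ≟ r | x ≟ k
    ... | yes refl | yes refl = contradiction refl k≢r
    ... | yes refl | no _     = subst (_≤ d x) (+-comm 1 _) deficient
    ... | no _     | yes refl = subst (_≤ d x) (+-comm 1 _) k<d
    ... | no _     | no _     = subst (_≤ d x) (sym (+-identityʳ _)) (below sub x)

    joins-swap : ∀ {x y u v : Fin n} → Joins x y u v → Joins y x u v
    joins-swap (inj₁ z) = inj₂ z
    joins-swap (inj₂ z) = inj₁ z

    raise-open : ∀ {k} → k ≢ r → adj G r k ≡ false → deg G k < d k → Raised G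
    raise-open {k} k≢r rk k<d with addEdge G (k≢r ∘ sym) rk
    ... | G′ , degs , same = raise-pair k G′ degs (fits-pair k≢r k<d)
      λ i j r<i r<j → trans (same (untouched ≤-refl r<i r<j ∘ joins-swap)) (indep sub i j r<i r<j)

    -- A private neighbour `u` of `i` trades its edge to `i` for one to `r`, and `i` makes up the
    -- loss by joining `k`. Thus `i` and `u` keep their degrees, while `r` and `k` gain.
    compensate : ∀ {i k} → toℕ i < toℕ r → k ≢ i → adj G i k ≡ false →
                 (∀ u → adj G u i ≡ true → adj G u r ≡ false → u ≢ r → u ≢ k) →
                 (∀ x → deg G x + (e r x + e k x) ≤ d x) → Raised G
    compensate {i} {k} i<r k≢i ik u≢ks fits with private-neighbour G (earlier-higher i<r)
    ... | u , u≢r , ui , ur with moveEdge G {u} {i} {r} (λ { refl → <-irrefl refl i<r }) u≢r ui ur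
    ... | G₁ , degs₁ , same₁ with addEdge G₁ {i} {k} (k≢i ∘ sym) (trans (same₁
            (λ { (inj₁ (refl , _)) → adj⇒≢ G ui refl ; (inj₂ (_ , refl)) → u≢ks u ui ur u≢r refl })
            (λ { (inj₁ (refl , _)) → adj⇒≢ G ui refl ; (inj₂ (refl , _)) → <-irrefl refl i<r })) ik)
    ... | G₂ , degs₂ , same₂ = raise-pair k G₂ degs fits λ x y r<x r<y →
            trans (same₂ (untouched (<⇒≤ i<r) r<x r<y ∘ joins-swap))
              (trans (same₁ (untouched (<⇒≤ i<r) r<x r<y) (untouched ≤-refl r<x r<y)) (indep sub x y r<x r<y))
      where
      degs : ∀ x → deg G₂ x ≡ deg G x + (e r x + e k x)
      degs x = begin
        deg G₂ x                       ≡⟨ degs₂ x ⟩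
        deg G₁ x + (e i x + e k x)     ≡⟨ +-assoc (deg G₁ x) _ _ ⟨
        deg G₁ x + e i x + e k x       ≡⟨ cong (_+ e k x) (degs₁ x) ⟩
        deg G x + e r x + e k x        ≡⟨ +-assoc (deg G x) _ _ ⟩
        deg G x + (e r x + e k x)      ∎
        where open ≡-Reasoning

    -- Two moves: `a` trades `w` for `b`, then a private neighbour `u` of `b` trades `b` for `r`. In
    -- total one unit of degree passes from the later vertex `w` to `r`. The last hypothesis keeps
    -- `u` apart from `a`.
    exchange : ∀ {a b w} → toℕ r < toℕ w → toℕ b < toℕ r → toℕ a ≤ toℕ r → a ≢ b →
               adj G a w ≡ true → adj G a b ≡ false →
               (∀ u → u ≢ r → adj G u r ≡ false → u ≢ a) → Raised G
    exchange {a} {b} {w} r<w b<r a≤r a≢b aw ab u≢as with private-neighbour G (earlier-higher b<r)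
    ... | u , u≢r , ub , ur = rotated (moveEdge G {a} {w} {b} w≢b a≢b aw ab)
      where
      w≢b : w ≢ b
      w≢b refl = <-asym r<w b<r
      b≢r : b ≢ r
      b≢r refl = <-irrefl refl b<r
      u≢a : u ≢ a
      u≢a = u≢as u u≢r ur
      u≢b : u ≢ b
      u≢b = adj⇒≢ G ub

      rotated : Σ[ G₁ ∈ Graph n ] (∀ x → deg G₁ x + e w x ≡ deg G x + e b x) ×
                  (∀ {x y} → ¬ Joins a w x y → ¬ Joins a b x y → adj G₁ x y ≡ adj G x y) → Raised G
      rotated (G₁ , degs₁ , same₁) with moveEdge G₁ {u} {b} {r} b≢r u≢r
        (trans (same₁ (λ { (inj₁ (u≡a , _)) → u≢a u≡a ; (inj₂ (_ , b≡a)) → a≢b (sym b≡a) })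
                      (λ { (inj₁ (u≡a , _)) → u≢a u≡a ; (inj₂ (u≡b , _)) → u≢b u≡b })) ub)
        (trans (same₁ (λ { (inj₁ (u≡a , _)) → u≢a u≡a
                         ; (inj₂ (refl , refl)) → contradiction (trans (sym aw) (trans (adj-sym G a u) ur)) λ () })
                      (λ { (inj₁ (u≡a , _)) → u≢a u≡a ; (inj₂ (u≡b , _)) → u≢b u≡b })) ur)
      ... | G₂ , degs₂ , same₂ = raise-from w r<w G₂ degs λ x y r<x r<y →
        trans (same₂ (untouched (<⇒≤ b<r) r<x r<y) (untouched ≤-refl r<x r<y))
          (trans (same₁ (untouched a≤r r<x r<y ∘ joins-swap) (untouched (<⇒≤ b<r) r<x r<y)) (indep sub x y r<x r<y))
        where
        degs : ∀ x → deg G₂ x + e w x ≡ deg G x + e r x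
        degs x = +-cancelʳ-≡ (e b x) _ _ (begin
          deg G₂ x + e w x + e b x     ≡⟨ rearrange (deg G₂ x) _ _ ⟩
          deg G₂ x + e b x + e w x     ≡⟨ cong (_+ e w x) (degs₂ x) ⟩
          deg G₁ x + e r x + e w x     ≡⟨ rearrange (deg G₁ x) _ _ ⟩
          deg G₁ x + e w x + e r x     ≡⟨ cong (_+ e r x) (degs₁ x) ⟩
          deg G x + e b x + e r x      ≡⟨ rearrange (deg G x) _ _ ⟩
          deg G x + e r x + e b x      ∎)
          where
          open ≡-Reasoning
          rearrange : ∀ a b c → a + b + c ≡ a + c + b
          rearrange = solve-∀

    -- If all other vertices had their prescribed degrees, ∑ d would exceed twice the number of
    -- edges by exactly one, against its parity.
    another-deficient : d r ≡ suc (deg G r) → ∃[ k ] k ≢ r × deg G k < d k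
    another-deficient dr with any? (λ k → ¬? (k ≟ r) ×-dec (deg G k <? d k))
    ... | yes found = found
    ... | no none = contradiction parity (even≢odd half (size G))
      where
      open ≡-Reasoning
      parity : 2 * half ≡ suc (2 * size G)
      parity = +-cancelʳ-≡ (deg G r) _ _ (begin
        2 * half + deg G r           ≡⟨ cong (_+ deg G r) even ⟨
        ∑ d + deg G r                ≡⟨ ∑-update r (λ k k≢r → ≤-antisym
                                          (≮⇒≥ λ k<d → none (k , k≢r , k<d)) (below sub k)) ⟩
        ∑ (deg G) + d r              ≡⟨ cong₂ _+_ (∑-deg G) dr ⟩
        2 * size G + suc (deg G r)   ≡⟨ +-suc _ _ ⟩
        suc (2 * size G) + deg G r   ∎)

    -- If `r` lacks at least two, `compensate` works with `k = r`: one new edge comes from the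
    -- private neighbour, the other joins `r` to `i`. If `r` lacks exactly one, parity supplies a
    -- deficient later vertex adjacent to `r`, and that edge is exchanged for the edge to `i`.
    raise-nonneighbour : (∀ k → k ≢ r → deg G k < d k → adj G r k ≡ true) →
                         ∀ {i} → toℕ i < toℕ r → adj G r i ≡ false → Raised G
    raise-nonneighbour saturated {i} i<r ri with suc (deg G r) <? d r
    ... | yes big = compensate i<r (λ { refl → <-irrefl refl i<r }) (trans (adj-sym G i r) ri) (λ _ _ _ u≢r → u≢r) fits
      where
      fits : ∀ x → deg G x + (e r x + e r x) ≤ d x
      fits x with x ≟ r
      ... | yes refl = subst (_≤ d r) (+-comm 2 _) big
      ... | no _     = subst (_≤ d x) (sym (+-identityʳ _)) (below sub x)
    ... | no small with another-deficient (≤-antisym (≮⇒≥ small) deficient)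
    ... | k , k≢r , k<d = exchange (r<k k≢r k<d) i<r ≤-refl (λ { refl → <-irrefl refl i<r })
                            (saturated k k≢r k<d) ri (λ _ u≢r _ → u≢r)

    S : Fin n → Bool
    S i = does (toℕ i ≤? toℕ r)

    S⇒≤ : ∀ i → S i ≡ true → toℕ i ≤ toℕ r
    S⇒≤ i Si = ≮⇒≥ λ r<i → contradiction (trans (sym Si) (dec-false (toℕ i ≤? toℕ r) (<⇒≱ r<i))) λ ()

    ¬S⇒> : ∀ i → S i ≡ false → toℕ r < toℕ i
    ¬S⇒> i ¬Si = ≰⇒> λ i≤r → contradiction (trans (sym (dec-true (toℕ i ≤? toℕ r) i≤r)) ¬Si) λ ()

    neighbour-of : (∀ i → toℕ i < toℕ r → adj G r i ≡ true) → ∀ {i} → toℕ i < toℕ r → ∀ u → adj G u r ≡ false → u ≢ i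
    neighbour-of all {i} i<r u ur refl = contradiction (trans (sym (all i i<r)) (trans (adj-sym G r u) ur)) λ ()

    -- When no move is left, `S` is a clique, the later vertices are independent, and each later `j`
    -- has degree at least min(d j, |S|). By `split-degree-sum` the actual degrees then already use
    -- up the right side of the inequality for `S`, and the deficiency of `r` violates it.
    not-saturated : (∀ i → toℕ i < toℕ r → adj G r i ≡ true) →
                    (∀ k → ¬ (S k ≡ false × deg G k < d k × deg G k < ∑ (member S))) →
                    (∀ i j → ¬ (toℕ i < toℕ r × toℕ j < toℕ r × i ≢ j × adj G i j ≡ false)) → ⊥
    not-saturated all full clique = <-irrefl refl (begin-strict
      ∑ (λ i → s i * deg G i) + ∑ s
        <⟨ +-monoˡ-< (∑ s) (∑-mono-< (λ i → *-monoʳ-≤ (s i) (below sub i)) r r-strict) ⟩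
      ∑ (λ i → s i * d i) + ∑ s                          ≤⟨ erdősGallai S ⟩
      ∑ s * ∑ s + ∑ (λ j → nonmember S j * (d j ⊓ ∑ s))  ≤⟨ +-monoʳ-≤ (∑ s * ∑ s) (∑-mono-≤ outer) ⟩
      ∑ s * ∑ s + ∑ (λ j → nonmember S j * deg G j)      ≡⟨ split-degree-sum G S adjacent independent ⟨
      ∑ (λ i → s i * deg G i) + ∑ s                      ∎)
      where
      open ≤-Reasoning
      s = member S

      r-strict : s r * deg G r < s r * d r
      r-strict rewrite dec-true (toℕ r ≤? toℕ r) ≤-refl = subst₂ _<_ (sym (+-identityʳ _)) (sym (+-identityʳ _)) deficient

      outer : ∀ j → nonmember S j * (d j ⊓ ∑ s) ≤ nonmember S j * deg G j
      outer j with S j in Sj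
      ... | true = z≤n
      ... | false with deg G j <? d j
      ...   | no deg≮d = +-monoˡ-≤ 0 (≤-trans (m⊓n≤m (d j) (∑ s)) (≮⇒≥ deg≮d))
      ...   | yes deg<d = +-monoˡ-≤ 0 (≤-trans (m⊓n≤n (d j) (∑ s)) (≮⇒≥ λ deg<s → full j (Sj , deg<d , deg<s)))

      adjacent : ∀ i j → S i ≡ true → S j ≡ true → i ≢ j → adj G i j ≡ true
      adjacent i j Si Sj i≢j with m≤n⇒m<n∨m≡n (S⇒≤ i Si) | m≤n⇒m<n∨m≡n (S⇒≤ j Sj)
      ... | inj₁ i<r | inj₁ j<r = ≢false⇒≡true λ ij → clique i j (i<r , j<r , i≢j , ij)
      ... | inj₁ i<r | inj₂ j≡r rewrite toℕ-injective j≡r = trans (adj-sym G i r) (all i i<r)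
      ... | inj₂ i≡r | inj₁ j<r rewrite toℕ-injective i≡r = all j j<r
      ... | inj₂ i≡r | inj₂ j≡r = contradiction (toℕ-injective (trans i≡r (sym j≡r))) i≢j

      independent : ∀ i j → S i ≡ false → S j ≡ false → adj G i j ≡ false
      independent i j ¬Si ¬Sj = indep sub i j (¬S⇒> i ¬Si) (¬S⇒> j ¬Sj)

    -- The searches are ordered so that each failure is a hypothesis of the next case: deficient
    -- vertices other than `r` are adjacent to `r`, and then so are all earlier vertices.
    raise : Raised G
    raise with any? (λ k → ¬? (k ≟ r) ×-dec (adj G r k ≟ᵇ false) ×-dec (deg G k <? d k))
    ... | yes (k , k≢r , rk , k<d) = raise-open k≢r rk k<d
    ... | no none with any? (λ i → (toℕ i <? toℕ r) ×-dec (adj G r i ≟ᵇ false))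
    ...   | yes (i , i<r , ri) =
            raise-nonneighbour (λ k k≢r k<d → ≢false⇒≡true λ rk → none (k , k≢r , rk , k<d)) i<r ri
    ...   | no all′ = go
      where
      saturated : ∀ k → k ≢ r → deg G k < d k → adj G r k ≡ true
      saturated k k≢r k<d = ≢false⇒≡true λ rk → none (k , k≢r , rk , k<d)

      all : ∀ i → toℕ i < toℕ r → adj G r i ≡ true
      all i i<r = ≢false⇒≡true λ ri → all′ (i , i<r , ri)

      go : Raised G
      go with any? (λ k → (S k ≟ᵇ false) ×-dec (deg G k <? d k) ×-dec (deg G k <? ∑ (member S)))
      ... | yes (k , ¬Sk , k<d , k<S) = unfilled (missing-neighbour G S k k<S)
        where
        r<ᵏ : toℕ r < toℕ k
        r<ᵏ = ¬S⇒> k ¬Sk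

        k≢r : k ≢ r
        k≢r refl = <-irrefl refl r<ᵏ

        -- The vertex of `S` missed by `k` cannot be `r`, because a deficient `k` is adjacent to
        -- `r`. So it is a finished vertex, and joining it to `k` can be compensated.
        unfilled : (∃[ i ] S i ≡ true × adj G k i ≡ false) → Raised G
        unfilled (i , Si , ki) with m≤n⇒m<n∨m≡n (S⇒≤ i Si)
        ... | inj₂ i≡r rewrite toℕ-injective i≡r =
          contradiction (trans (sym (saturated k k≢r k<d)) (trans (adj-sym G r k) ki)) λ ()
        ... | inj₁ i<r = compensate i<r (λ { refl → <-asym i<r r<ᵏ }) (trans (adj-sym G i k) ki)
          (λ { u _ ur _ refl → contradiction (trans (sym (saturated k k≢r k<d)) (trans (adj-sym G r k) ur)) λ () })
          (fits-pair k≢r k<d)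
      ... | no full with any? (λ i → any? (λ j →
            (toℕ i <? toℕ r) ×-dec (toℕ j <? toℕ r) ×-dec ¬? (i ≟ j) ×-dec (adj G i j ≟ᵇ false)))
      ...   | no clique = ⊥-elim (not-saturated all (λ k z → full (k , z)) (λ i j z → clique (i , j , z)))
      ...   | yes (i , j , i<r , j<r , i≢j , ij) with private-neighbour G (earlier-higher j<r)
      -- All earlier vertices are adjacent to `r` and `w` is not, so `w` lies after `r`; here `j`
      -- trades `w` for `i`.
      ...     | w , w≢r , wj , wr = exchange r<w i<r (<⇒≤ j<r) (i≢j ∘ sym)
                  (trans (adj-sym G j w) wj) (trans (adj-sym G j i) ij) (λ u _ ur → neighbour-of all j<r u ur)
        where
        r<w : toℕ r < toℕ w
        r<w with <-cmp (toℕ w) (toℕ r)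
        ... | tri< w<r _ _ = contradiction refl (neighbour-of all w<r w wr)
        ... | tri≈ _ w≡r _ = contradiction (toℕ-injective w≡r) w≢r
        ... | tri> _ _ r<w = r<w

module _ {n} (d : Fin n → ℕ) (antitone : ∀ i j → toℕ i ≤ toℕ j → d j ≤ d i)
         (half : ℕ) (even : ∑ d ≡ 2 * half) (erdősGallai : ErdősGallai d) where

  tighten : ∀ r fuel G → Subrealization d (toℕ r) G → d r ≤ deg G r + fuel →
            Σ[ G′ ∈ Graph n ] Subrealization d (toℕ r) G′ × deg G′ r ≡ d r
  tighten r fuel G sub d≤ with deg G r <? d r
  ... | no  deg≮d = G , sub , ≤-antisym (Subrealization.below sub r) (≮⇒≥ deg≮d)
  tighten r zero    G sub d≤ | yes deg<d = contradiction (subst (d r ≤_) (+-identityʳ _) d≤) (<⇒≱ deg<d)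
  tighten r (suc f) G sub d≤ | yes deg<d with raise d antitone half even erdősGallai r G sub deg<d
  ... | G′ , sub′ , up = tighten r f G′ sub′ (≤-trans d≤ (≤-trans (≤-reflexive (+-suc _ f)) (+-monoˡ-≤ f up)))

  emptyGraph : Graph n
  emptyGraph .adj u v = false
  emptyGraph .irrefl u = refl
  emptyGraph .adj-sym u v = refl

  subrealization : ∀ r → r ≤ n → Σ[ G ∈ Graph n ] Subrealization d r G
  subrealization zero _ = emptyGraph , record
    { below = λ i → subst (_≤ d i) (sym (trans (deg≡∑ emptyGraph i) (sum-replicate-zero n))) z≤n
    ; tight = λ i ()
    ; indep = λ i j _ _ → refl
    }
  subrealization (suc r) r<n with subrealization r (<⇒≤ r<n)
  ... | G , sub with tighten (fromℕ< r<n) (d (fromℕ< r<n)) G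
                       (subst (λ z → Subrealization d z G) (sym (toℕ-fromℕ< r<n)) sub) (m≤n+m _ _)
  ... | G′ , sub′ , tight-r rewrite toℕ-fromℕ< r<n = G′ , record
    { below = Subrealization.below sub′
    ; tight = tight′
    ; indep = λ i j r<i r<j → Subrealization.indep sub′ i j (<⇒≤ r<i) (<⇒≤ r<j)
    }
    where
    tight′ : ∀ i → toℕ i < suc r → deg G′ i ≡ d i
    tight′ i i<1+r with m≤n⇒m<n∨m≡n (s≤s⁻¹ i<1+r)
    ... | inj₁ i<r = Subrealization.tight sub′ i i<r
    ... | inj₂ i≡r = subst (λ z → deg G′ z ≡ d z) (toℕ-injective (trans (toℕ-fromℕ< r<n) (sym i≡r))) tight-r

  realization : Σ[ G ∈ Graph n ] (∀ i → deg G i ≡ d i)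
  realization with subrealization n ≤-refl
  ... | G , sub = G , λ i → Subrealization.tight sub i (toℕ<n i)

-- Written additively, so that no subtraction is needed for p (p ∸ 1).
ErdősGallaiList : List ℕ → Set
ErdősGallaiList xs = ∀ as bs → xs ↭ as ++ bs →
  sum as + length as ≤ length as * length as + sum (map (_⊓ length as) bs)

split-tabulate : ∀ {n} (d : Fin n → ℕ) (S : Fin n → Bool) →
  ∃[ as ] ∃[ bs ] (tabulate d ↭ as ++ bs) × sum as ≡ ∑ (λ i → member S i * d i) ×
    length as ≡ ∑ (member S) × (∀ p → sum (map (_⊓ p) bs) ≡ ∑ (λ j → nonmember S j * (d j ⊓ p)))
split-tabulate {zero}  d S = [] , [] , ↭-refl , refl , refl , λ _ → refl
split-tabulate {suc n} d S with split-tabulate (d ∘ suc) (S ∘ suc) | S zero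
... | as , bs , perm , sum-as , len-as , sum-bs | true  =
  d zero ∷ as , bs , prep _ perm , cong₂ _+_ (sym (+-identityʳ _)) sum-as , cong suc len-as , sum-bs
... | as , bs , perm , sum-as , len-as , sum-bs | false =
  as , d zero ∷ bs , ↭-trans (prep _ perm) (↭-sym (shift (d zero) as bs)) , sum-as , len-as ,
  λ p → cong₂ _+_ (sym (+-identityʳ _)) (sum-bs p)

ErdősGallai-tabulate : ∀ {n} (d : Fin n → ℕ) → ErdősGallaiList (tabulate d) → ErdősGallai d
ErdősGallai-tabulate d eg S with split-tabulate d S
... | as , bs , perm , sum-as , len-as , sum-bs =
  subst₂ _≤_ (cong₂ _+_ sum-as len-as)
    (cong₂ _+_ (cong₂ _*_ len-as len-as) (trans (sum-bs (length as))
      (cong (λ p → ∑ (λ j → nonmember S j * (d j ⊓ p))) len-as)))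
    (eg as bs perm)

≥-decTotalOrder : DecTotalOrder _ _ _
≥-decTotalOrder = Flip.decTotalOrder ≤-decTotalOrder

erdősGallai⇒graphic : ∀ xs half → sum xs ≡ 2 * half → ErdősGallaiList xs → Graphic xs
erdősGallai⇒graphic xs half even eg = length ys , G , perm
  where
  ys = sort ≥-decTotalOrder xs
  ys↭xs = sort-↭ ≥-decTotalOrder xs
  d = lookup ys

  tab : tabulate d ≡ ys
  tab = tabulate-lookup ys

  realized = realization d
    (λ i j i≤j → lookup-mono-≤ (DecTotalOrder.totalOrder ≥-decTotalOrder) (sort-↗ ≥-decTotalOrder xs) i≤j)
    half (trans (sym (sum-tabulate d)) (trans (cong sum tab) (trans (sum-↭ ys↭xs) even)))
    (ErdősGallai-tabulate d (subst ErdősGallaiList (sym tab) λ as bs p → eg as bs (↭-trans (↭-sym ys↭xs) p)))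

  G = proj₁ realized

  perm : degrees G ↭ xs
  perm = ↭-trans (↭-reflexive (trans (map-tabulate id (deg G)) (trans (tabulate-cong (proj₂ realized)) tab))) ys↭xs

-- The inequalities for P

-- The sequence P, by recursion on t and with the multiplicity r of its largest term as a parameter.
stair : (δ h t s r : ℕ) → List ℕ
stair δ h zero    s r = replicate r δ
stair δ h (suc t) s r = replicate s δ ++ stair (δ + h) h t s r

P≡stair : ∀ δ h t n s → P δ h t n s ≡ stair δ h t s (n ∸ t * s)
P≡stair δ h t n s = go δ t (n ∸ t * s)
  where
  open ≡-Reasoning
  block : ℕ → ℕ → List ℕ
  block δ i = replicate s (δ + i * h)

  go : ∀ δ t r → concatMap (block δ) (upTo t) ++ replicate r (δ + t * h) ≡ stair δ h t s r
  go δ zero    r = cong (replicate r) (+-identityʳ δ)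
  go δ (suc t) r = begin
    concatMap (block δ) (upTo (suc t)) ++ replicate r (δ + (h + t * h))
      ≡⟨ cong (λ is → concatMap (block δ) (0 ∷ is) ++ replicate r (δ + (h + t * h))) (map-upTo suc t) ⟨
    (block δ 0 ++ concatMap (block δ) (map suc (upTo t))) ++ replicate r (δ + (h + t * h))
      ≡⟨ ++-assoc (block δ 0) _ _ ⟩
    block δ 0 ++ concatMap (block δ) (map suc (upTo t)) ++ replicate r (δ + (h + t * h))
      ≡⟨ cong₂ _++_ (cong (replicate s) (+-identityʳ δ)) (cong₂ _++_
           (trans (concatMap-map (block δ) suc (upTo t))
                  (concatMap-cong (λ i → cong (replicate s) (sym (+-assoc δ h (i * h)))) (upTo t)))
           (cong (replicate r) (sym (+-assoc δ h (t * h))))) ⟩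
    replicate s δ ++ concatMap (block (δ + h)) (upTo t) ++ replicate r (δ + h + t * h)
      ≡⟨ cong (replicate s δ ++_) (go (δ + h) t r) ⟩
    stair δ h (suc t) s r ∎

-- Discards an empty top block: the next block below, of multiplicity `s`, becomes the top.
stair-full : ∀ δ h t s → stair δ h (suc t) s 0 ≡ stair δ h t s s
stair-full δ h zero    s = ++-identityʳ (replicate s δ)
stair-full δ h (suc t) s = cong (replicate s δ ++_) (stair-full (δ + h) h t s)

length-stair : ∀ δ h t s r → length (stair δ h t s r) ≡ t * s + r
length-stair δ h zero    s r = length-replicate r
length-stair δ h (suc t) s r = begin
  length (replicate s δ ++ stair (δ + h) h t s r)        ≡⟨ length-++ (replicate s δ) ⟩
  length (replicate s δ) + length (stair (δ + h) h t s r) ≡⟨ cong₂ _+_ (length-replicate s) (length-stair (δ + h) h t s r) ⟩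
  s + (t * s + r)                                         ≡⟨ +-assoc s (t * s) r ⟨
  s + t * s + r                                           ∎
  where open ≡-Reasoning

stair-≥ : ∀ δ h t s r → All (δ ≤_) (stair δ h t s r)
stair-≥ δ h zero    s r = All.replicate⁺ r ≤-refl
stair-≥ δ h (suc t) s r = All.++⁺ (All.replicate⁺ s ≤-refl) (All.map (≤-trans (m≤m+n δ h)) (stair-≥ (δ + h) h t s r))

stair-≤ : ∀ δ h t s r → All (_≤ δ + t * h) (stair δ h t s r)
stair-≤ δ h zero    s r = All.replicate⁺ r (≤-reflexive (sym (+-identityʳ δ)))
stair-≤ δ h (suc t) s r = All.++⁺ (All.replicate⁺ s (m≤m+n δ _))
  (All.map (λ x≤ → ≤-trans x≤ (≤-reflexive (+-assoc δ h (t * h)))) (stair-≤ (δ + h) h t s r))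

-- Bounds by the extreme terms, and the case of large n.

sum≤length* : ∀ {c xs} → All (_≤ c) xs → sum xs ≤ length xs * c
sum≤length* []         = z≤n
sum≤length* (x≤c ∷ xs) = +-mono-≤ x≤c (sum≤length* xs)

length*≤sum : ∀ {c xs} → All (c ≤_) xs → length xs * c ≤ sum xs
length*≤sum []         = z≤n
length*≤sum (c≤x ∷ xs) = +-mono-≤ c≤x (length*≤sum xs)

sum-map≤ : ∀ {f : ℕ → ℕ} {c xs} → All (λ x → f x ≤ c) xs → sum (map f xs) ≤ length xs * c
sum-map≤ {f} {c} {xs} all = subst (λ l → sum (map f xs) ≤ l * c) (length-map f xs) (sum≤length* (All.map⁺ all))

sum-map≥ : ∀ {f : ℕ → ℕ} {c xs} → All (λ x → c ≤ f x) xs → length xs * c ≤ sum (map f xs)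
sum-map≥ {f} {c} {xs} all = subst (λ l → l * c ≤ sum (map f xs)) (length-map f xs) (length*≤sum (All.map⁺ all))

sum-map-++ : ∀ (f : ℕ → ℕ) xs ys → sum (map f (xs ++ ys)) ≡ sum (map f xs) + sum (map f ys)
sum-map-++ f xs ys = trans (cong sum (map-++ f xs ys)) (sum-++ (map f xs) (map f ys))

-- Certificate for polynomial inequalities in ℕ: the difference R - L equals (B - A) + k, and the
-- identity can be left to the ring solver.
≤-by : ∀ {A B L R} k → A ≤ B → L + B + k ≡ R + A → L ≤ R
≤-by {A} {B} {L} {R} k A≤B eq = +-cancelʳ-≤ B L R (begin
  L + B      ≤⟨ m≤m+n (L + B) k ⟩
  L + B + k  ≡⟨ eq ⟩
  R + A      ≤⟨ +-monoʳ-≤ R A≤B ⟩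
  R + B      ∎)
  where open ≤-Reasoning

2ab≤a²+b² : ∀ a b → 2 * (a * b) ≤ a * a + b * b
2ab≤a²+b² a b with ≤-total a b
... | inj₁ a≤b with m≤n⇒∃[o]m+o≡n a≤b
...   | o , refl = ≤-trans (m≤m+n _ (o * o)) (≤-reflexive (square a o))
  where square : ∀ a o → 2 * (a * (a + o)) + o * o ≡ a * a + (a + o) * (a + o)
        square = solve-∀
2ab≤a²+b² a b | inj₂ b≤a with m≤n⇒∃[o]m+o≡n b≤a
...   | o , refl = ≤-trans (m≤m+n _ (o * o)) (≤-reflexive (square b o))
  where square : ∀ b o → 2 * ((b + o) * b) + o * o ≡ (b + o) * (b + o) + b * b
        square = solve-∀

sum≤threshold : ∀ v xs → sum xs ≤ length xs * v + sum (map (_∸ v) xs)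
sum≤threshold v []       = z≤n
sum≤threshold v (x ∷ xs) = begin
  x + sum xs                                               ≤⟨ +-mono-≤ (m≤n+m∸n x v) (sum≤threshold v xs) ⟩
  (v + (x ∸ v)) + (length xs * v + sum (map (_∸ v) xs))    ≡⟨ rearrange v (x ∸ v) (length xs * v) _ ⟩
  (v + length xs * v) + ((x ∸ v) + sum (map (_∸ v) xs))    ∎
  where
  open ≤-Reasoning
  rearrange : ∀ a b c d → (a + b) + (c + d) ≡ (a + c) + (b + d)
  rearrange = solve-∀

module Cut {δ Δ xs} (lower : All (δ ≤_) xs) (upper : All (_≤ Δ) xs) as bs (perm : xs ↭ as ++ bs) where

  p = length as
  q = length bs

  as-upper : All (_≤ Δ) as
  as-upper = All.++⁻ˡ as (All-resp-↭ perm upper)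

  bs-lower : All (δ ≤_) bs
  bs-lower = All.++⁻ʳ as (All-resp-↭ perm lower)

  length≡ : length xs ≡ p + q
  length≡ = trans (↭-length perm) (length-++ as)

  sum-map-cut : ∀ f → sum (map f xs) ≡ sum (map f as) + sum (map f bs)
  sum-map-cut f = trans (sum-↭ (map⁺ f perm)) (sum-map-++ f as bs)

  as-bound : sum as + p ≤ p * suc Δ
  as-bound = ≤-trans (+-monoˡ-≤ p (sum≤length* as-upper)) (≤-reflexive (trans (+-comm _ p) (sym (*-suc p Δ))))

  bs-bound : ∀ c → c ≤ δ → c ≤ p → q * c ≤ sum (map (_⊓ p) bs)
  bs-bound c c≤δ c≤p = sum-map≥ (All.map (λ δ≤b → ⊓-glb (≤-trans c≤δ δ≤b) c≤p) bs-lower)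

  -- For p ≤ δ every min(b, p) with `b` in `bs` equals p, so the right side is p times the full
  -- length.
  cut-small : Δ < length xs → p ≤ δ → sum as + p ≤ p * p + sum (map (_⊓ p) bs)
  cut-small Δ<n p≤δ = begin
    sum as + p                      ≤⟨ as-bound ⟩
    p * suc Δ                       ≤⟨ *-monoʳ-≤ p (≤-trans Δ<n (≤-reflexive length≡)) ⟩
    p * (p + q)                     ≡⟨ trans (*-distribˡ-+ p p q) (cong (p * p +_) (*-comm p q)) ⟩
    p * p + q * p                   ≤⟨ +-monoʳ-≤ (p * p) (bs-bound p p≤δ ≤-refl) ⟩
    p * p + sum (map (_⊓ p) bs)     ∎
    where open ≤-Reasoning

  cut-large : Δ < p → sum as + p ≤ p * p + sum (map (_⊓ p) bs)
  cut-large Δ<p = ≤-trans as-bound (≤-trans (*-monoʳ-≤ p Δ<p) (m≤m+n (p * p) _))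

-- For p ≥ δ it suffices that p(Δ + 1) ≤ p² + (n - p)δ, that is p(Y - p) ≤ nδ with Y = Δ + 1 + δ.
-- The left side is at most Y²/4, whence the bound n ≥ Y²/(4δ). The same bound yields Δ < n for the
-- case p ≤ δ, since Y² ≥ 4(Δ + 1)δ.
erdősGallai-long : ∀ δ Δ xs → 1 ≤ δ → All (δ ≤_) xs → All (_≤ Δ) xs →
                   (suc Δ + δ) * (suc Δ + δ) ≤ 4 * δ * length xs → ErdősGallaiList xs
erdősGallai-long δ@(suc _) Δ xs 1≤δ lower upper long as bs perm = cut
  where
  open ≤-Reasoning
  open Cut lower upper as bs perm
  Y = suc Δ + δ

  Δ<n : Δ < length xs
  Δ<n = *-cancelˡ-≤ (4 * δ) (≤-trans (≤-by 0 (2ab≤a²+b² (suc Δ) δ) (expand (suc Δ) δ)) long)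
    where expand : ∀ a b → 4 * b * a + (a * a + b * b) + 0 ≡ (a + b) * (a + b) + 2 * (a * b)
          expand = solve-∀

  middle : p * suc Δ ≤ p * p + q * δ
  middle = *-cancelˡ-≤ 4 (≤-by 0 (+-mono-≤ (2ab≤a²+b² (2 * p) Y)
             (subst (λ n → Y * Y ≤ 4 * δ * n) length≡ long)) (expand p q δ (suc Δ)))
    where expand : ∀ p q δ a → 4 * (p * a) + ((2 * p * (2 * p) + (a + δ) * (a + δ)) + 4 * δ * (p + q)) + 0 ≡
                               4 * (p * p + q * δ) + (2 * (2 * p * (a + δ)) + (a + δ) * (a + δ))
          expand = solve-∀

  cut : sum as + p ≤ p * p + sum (map (_⊓ p) bs)
  cut with ≤-total p δ
  ... | inj₁ p≤δ = cut-small Δ<n p≤δ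
  ... | inj₂ δ≤p = ≤-trans as-bound (≤-trans middle (+-monoʳ-≤ (p * p) (bs-bound δ ≤-refl δ≤p)))

-- Unit steps (k = 0): counting above and below a threshold.

tri : ℕ → ℕ
tri zero    = 0
tri (suc q) = suc q + tri q

2*tri : ∀ q → 2 * tri q ≡ q * suc q
2*tri zero    = refl
2*tri (suc q) = trans (*-distribˡ-+ 2 (suc q) (tri q)) (trans (cong (2 * suc q +_) (2*tri q)) (expand q))
  where expand : ∀ q → 2 * suc q + q * suc q ≡ suc q * suc (suc q)
        expand = solve-∀

sum-map-replicate : ∀ (f : ℕ → ℕ) s x → sum (map f (replicate s x)) ≡ s * f x
sum-map-replicate f zero    x = refl
sum-map-replicate f (suc s) x = cong (f x +_) (sum-map-replicate f s x)

sum-map-block : ∀ (f : ℕ → ℕ) s x xs → sum (map f (replicate s x ++ xs)) ≡ s * f x + sum (map f xs)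
sum-map-block f s x xs = trans (sum-map-++ f (replicate s x) xs) (cong (_+ sum (map f xs)) (sum-map-replicate f s x))

sum-map-∸ : ∀ c xs → All (suc c ≤_) xs → sum (map (_∸ c) xs) ≡ sum (map (_∸ suc c) xs) + length xs
sum-map-∸ c []       []          = refl
sum-map-∸ c (x ∷ xs) (c<x ∷ all) = begin
  (x ∸ c) + sum (map (_∸ c) xs)                            ≡⟨ cong₂ _+_ (+-∸-assoc 1 c<x) (sum-map-∸ c xs all) ⟩
  suc (x ∸ suc c) + (sum (map (_∸ suc c) xs) + length xs)  ≡⟨ rearrange (x ∸ suc c) _ _ ⟩
  (x ∸ suc c) + sum (map (_∸ suc c) xs) + suc (length xs)  ∎
  where
  open ≡-Reasoning
  rearrange : ∀ a b c → suc a + (b + c) ≡ a + b + suc c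
  rearrange = solve-∀

-- Above the threshold lie s copies of δ + c + j for 0 < j < q and r copies of δ + c + q, with total
-- excess qr + sq(q - 1)/2; adding `s * q` turns q(q - 1)/2 into `tri q`.
stair-excess : ∀ δ c q s r →
  sum (map (_∸ (δ + c)) (stair δ 1 (c + q) s r)) + s * q ≡ q * r + s * tri q
stair-excess δ zero zero s r rewrite sum-map-replicate (_∸ (δ + 0)) r δ | +-identityʳ δ | n∸n≡0 δ | *-zeroʳ r | *-zeroʳ s = refl
stair-excess δ zero (suc q) s r = begin
  sum (map (_∸ (δ + 0)) (replicate s δ ++ rest)) + s * suc q
    ≡⟨ cong (_+ s * suc q) (sum-map-block (_∸ (δ + 0)) s δ rest) ⟩
  s * (δ ∸ (δ + 0)) + sum (map (_∸ (δ + 0)) rest) + s * suc q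
    ≡⟨ cong₂ (λ x y → x + y + s * suc q) (trans (cong (s *_) (m≤n⇒m∸n≡0 (m≤m+n δ 0))) (*-zeroʳ s)) shifted ⟩
  sum (map (_∸ (δ + 1 + 0)) rest) + (q * s + r) + s * suc q
    ≡⟨ rearrange (sum (map (_∸ (δ + 1 + 0)) rest)) q s r ⟩
  sum (map (_∸ (δ + 1 + 0)) rest) + s * q + (s * suc q + r)
    ≡⟨ cong (_+ (s * suc q + r)) (stair-excess (δ + 1) zero q s r) ⟩
  q * r + s * tri q + (s * suc q + r)
    ≡⟨ collect q r s (tri q) ⟩
  suc q * r + s * tri (suc q) ∎
  where
  open ≡-Reasoning
  rest = stair (δ + 1) 1 q s r

  shifted : sum (map (_∸ (δ + 0)) rest) ≡ sum (map (_∸ (δ + 1 + 0)) rest) + (q * s + r)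
  shifted rewrite +-identityʳ δ | +-identityʳ (δ + 1) | +-comm δ 1 =
    trans (sum-map-∸ δ _ (stair-≥ (suc δ) 1 q s r)) (cong (sum (map (_∸ suc δ) (stair (suc δ) 1 q s r)) +_) (length-stair (suc δ) 1 q s r))

  rearrange : ∀ y q s r → y + (q * s + r) + s * suc q ≡ y + s * q + (s * suc q + r)
  rearrange = solve-∀

  collect : ∀ q r s t → q * r + s * t + (s * suc q + r) ≡ suc q * r + s * (suc q + t)
  collect = solve-∀
stair-excess δ (suc c) q s r
  rewrite sum-map-block (_∸ (δ + suc c)) s δ (stair (δ + 1) 1 (c + q) s r)
        | m≤n⇒m∸n≡0 (m≤m+n δ (suc c)) | *-zeroʳ s | sym (+-assoc δ 1 c) =
  stair-excess (δ + 1) c q s r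

-- A term δ + j with j < q falls short of δ + q by q - j, and there are s of each, so the total
-- shortfall is s times `tri q`.
stair-truncated : ∀ δ q c s r →
  ((q + c) * s + r) * (δ + q) ≤ sum (map (_⊓ (δ + q)) (stair δ 1 (q + c) s r)) + s * tri q
stair-truncated δ zero c s r = begin
  (c * s + r) * (δ + 0)                              ≡⟨ cong₂ _*_ (sym (length-stair δ 1 c s r)) (+-identityʳ δ) ⟩
  length (stair δ 1 c s r) * δ
    ≤⟨ sum-map≥ (All.map (λ δ≤x → ⊓-glb δ≤x (m≤m+n δ 0)) (stair-≥ δ 1 c s r)) ⟩
  sum (map (_⊓ (δ + 0)) (stair δ 1 c s r))           ≤⟨ m≤m+n _ (s * 0) ⟩
  sum (map (_⊓ (δ + 0)) (stair δ 1 c s r)) + s * 0   ∎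
  where open ≤-Reasoning
stair-truncated δ (suc q) c s r = begin
  (s + (q + c) * s + r) * (δ + suc q)               ≡⟨ expand δ q c s r ⟩
  ((q + c) * s + r) * (δ + 1 + q) + s * δ + s * suc q
    ≤⟨ +-monoˡ-≤ (s * suc q) (+-monoˡ-≤ (s * δ) (stair-truncated (δ + 1) q c s r)) ⟩
  M′ + s * tri q + s * δ + s * suc q                ≡⟨ collect M′ s δ q (tri q) ⟩
  s * δ + M′ + s * (suc q + tri q)                  ≡⟨ cong (_+ s * tri (suc q)) whole ⟨
  sum (map (_⊓ (δ + suc q)) (replicate s δ ++ rest)) + s * tri (suc q) ∎
  where
  open ≤-Reasoning
  rest = stair (δ + 1) 1 (q + c) s r
  M′ = sum (map (_⊓ (δ + 1 + q)) rest)

  whole : sum (map (_⊓ (δ + suc q)) (replicate s δ ++ rest)) ≡ s * δ + M′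
  whole = trans (sum-map-block (_⊓ (δ + suc q)) s δ rest)
    (cong₂ (λ x y → s * x + sum (map (_⊓ y) rest)) (m≤n⇒m⊓n≡m (m≤m+n δ (suc q))) (sym (+-assoc δ 1 q)))

  expand : ∀ δ q c s r → (s + (q + c) * s + r) * (δ + suc q) ≡ ((q + c) * s + r) * (δ + 1 + q) + s * δ + s * suc q
  expand = solve-∀

  collect : ∀ m s δ q t → m + s * t + s * δ + s * suc q ≡ s * δ + m + s * (suc q + t)
  collect = solve-∀

-- With s ≤ 1 there would be at most t + 1 ≤ δ + t terms.
multiplicity≥2 : ∀ {δ t s r} → 1 ≤ δ → 1 ≤ t → r ≤ s → δ + t < t * s + r → ∃[ s′ ] s ≡ 2 + s′
multiplicity≥2 {δ} {t} {suc (suc s′)} _ _ _ _ = s′ , refl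
multiplicity≥2 {δ} {t} {zero} {zero} _ _ z≤n wide = contradiction wide (subst (λ z → ¬ (δ + t < z + 0)) (sym (*-zeroʳ t)) n≮0)
multiplicity≥2 {δ} {t} {suc zero} {r} 1≤δ _ r≤1 wide = contradiction wide (≤⇒≯ (begin
  t * 1 + r  ≡⟨ cong (_+ r) (*-identityʳ t) ⟩
  t + r      ≤⟨ +-monoʳ-≤ t (≤-trans r≤1 1≤δ) ⟩
  t + δ      ≡⟨ +-comm t δ ⟩
  δ + t      ∎))
  where open ≤-Reasoning

-- What remains to be shown once `as-threshold` and `bs-truncated` are added. Here `w` is the
-- surplus of the length over δ + t + 1; writing s = 2 + s′ turns the slack into a polynomial with
-- nonnegative coefficients.
middle-bound : ∀ {δ k c s′ r w t s p} → t ≡ k + suc c → s ≡ 2 + s′ → p ≡ δ + k → suc (δ + t) + w ≡ t * s + r →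
               p * suc (δ + suc c) + k * r + s * (k * k) ≤ (t * s + r) * p
middle-bound {δ} {k} {c} {s′} {r} {w} refl refl refl n≡ =
  subst (λ n → (δ + k) * suc (δ + suc c) + k * r + (2 + s′) * (k * k) ≤ n * (δ + k)) n≡
    (≤-by (δ * w + k * (c + suc c * s′)) (*-monoʳ-≤ k (≤-reflexive (sym n≡))) (expand δ k c s′ r w))
  where
  expand : ∀ δ k c s′ r w →
    (δ + k) * suc (δ + suc c) + k * r + (2 + s′) * (k * k) + k * (suc (δ + (k + suc c)) + w) +
      (δ * w + k * (c + suc c * s′)) ≡
    (suc (δ + (k + suc c)) + w) * (δ + k) + k * ((k + suc c) * (2 + s′) + r)
  expand = solve-∀

-- For p = Δ every term of the sequence is at most p, so min(p , b) = b ≥ δ outside the first part.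
top-bound : ∀ {δ t r s q} → 1 ≤ δ → 1 ≤ t → (∃[ s′ ] s ≡ 2 + s′) → δ + t < t * s + r → t * s + r ≡ δ + t + q → r ≤ q * δ
top-bound {suc δ} {suc t} {r} {q = zero} _ _ (s′ , refl) wide n≡ =
  contradiction wide (≤⇒≯ (≤-reflexive (trans n≡ (+-identityʳ _))))
top-bound {suc δ} {suc t} {r} {q = suc w} _ _ (s′ , refl) wide n≡ =
  ≤-by (w * δ + t + suc t * s′) (≤-reflexive n≡) (expand δ t r s′ w)
  where
  expand : ∀ δ t r s′ w → r + (suc δ + suc t + suc w) + (w * δ + t + suc t * s′) ≡
                          suc w * suc δ + (suc t * (2 + s′) + r)
  expand = solve-∀

module Middle {δ t s r} (1≤δ : 1 ≤ δ) (r≤s : r ≤ s) (wide : δ + t < t * s + r) as bs (perm : stair δ 1 t s r ↭ as ++ bs) where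

  open Cut (stair-≥ δ 1 t s r) (stair-≤ δ 1 t s r) as bs perm public
  open ≤-Reasoning

  n≡ : t * s + r ≡ p + q
  n≡ = trans (sym (length-stair δ 1 t s r)) length≡

  -- Each chosen term is at most v = δ + c plus its excess over v, and the excess of the chosen
  -- terms is at most that of the whole sequence.
  as-threshold : ∀ c k → t ≡ c + k → sum as + s * k ≤ p * (δ + c) + (k * r + s * tri k)
  as-threshold c k t≡ = begin
    sum as + s * k                                                   ≤⟨ +-monoˡ-≤ (s * k) (sum≤threshold v as) ⟩
    p * v + sum (map (_∸ v) as) + s * k                              ≤⟨ +-monoˡ-≤ (s * k) (+-monoʳ-≤ (p * v) (m≤m+n _ _)) ⟩
    p * v + (sum (map (_∸ v) as) + sum (map (_∸ v) bs)) + s * k      ≡⟨ cong (λ z → p * v + z + s * k) (sum-map-cut (_∸ v)) ⟨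
    p * v + sum (map (_∸ v) (stair δ 1 t s r)) + s * k               ≡⟨ +-assoc (p * v) _ _ ⟩
    p * v + (sum (map (_∸ v) (stair δ 1 t s r)) + s * k)
      ≡⟨ cong (λ z → p * v + (sum (map (_∸ v) (stair δ 1 z s r)) + s * k)) t≡ ⟩
    p * v + (sum (map (_∸ v) (stair δ 1 (c + k) s r)) + s * k)       ≡⟨ cong (p * v +_) (stair-excess δ c k s r) ⟩
    p * v + (k * r + s * tri k)                                      ∎
    where v = δ + c

  -- The p chosen terms take at most p each from the truncated sum of the whole sequence; the rest
  -- belongs to `bs`.
  bs-truncated : ∀ k c → t ≡ k + c → p ≡ δ + k → (t * s + r) * p ≤ p * p + sum (map (_⊓ p) bs) + s * tri k
  bs-truncated k c t≡ p≡ = begin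
    (t * s + r) * p                                                ≡⟨ cong₂ (λ y z → (y * s + r) * z) t≡ p≡ ⟩
    ((k + c) * s + r) * (δ + k)                                    ≤⟨ stair-truncated δ k c s r ⟩
    sum (map (_⊓ (δ + k)) (stair δ 1 (k + c) s r)) + s * tri k
      ≡⟨ cong₂ (λ y z → sum (map (_⊓ z) (stair δ 1 y s r)) + s * tri k) t≡ p≡ ⟨
    sum (map (_⊓ p) (stair δ 1 t s r)) + s * tri k                 ≡⟨ cong (_+ s * tri k) (sum-map-cut (_⊓ p)) ⟩
    sum (map (_⊓ p) as) + sum (map (_⊓ p) bs) + s * tri k
      ≤⟨ +-monoˡ-≤ (s * tri k) (+-monoˡ-≤ _ (sum-map≤ (All.universal (λ x → m⊓n≤n x p) as))) ⟩
    p * p + sum (map (_⊓ p) bs) + s * tri k                        ∎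

  -- The threshold lies k steps below the top and the truncation point p lies k steps above the
  -- bottom, so `s * tri k` occurs twice. Since 2 * tri k = k² + k, the `s * k` of `as-threshold`
  -- cancels and s k² is left for `middle-bound`.
  cut-middle : ∀ k c → t ≡ k + suc c → p ≡ δ + k → sum as + p ≤ p * p + sum (map (_⊓ p) bs)
  cut-middle k c t≡ p≡ with multiplicity≥2 1≤δ (subst (1 ≤_) (sym (trans t≡ (+-suc k c))) (s≤s z≤n)) r≤s wide
                          | m≤n⇒∃[o]m+o≡n wide
  ... | s′ , s≡ | w , n≡′ = ≤-by 0
        (+-mono-≤ (+-mono-≤ (as-threshold (suc c) k (trans t≡ (+-comm k (suc c)))) (bs-truncated k (suc c) t≡ p≡))
                  (middle-bound t≡ s≡ p≡ n≡′))
        (collect (sum as) p (sum (map (_⊓ p) bs)) s k (δ + suc c) r (tri k) (t * s + r) (2*tri k))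
    where
    collect : ∀ a p m s k v r t n → 2 * t ≡ k * suc k →
      a + p + (p * v + (k * r + s * t) + (p * p + m + s * t) + n * p) + 0 ≡
      p * p + m + (a + s * k + n * p + (p * suc v + k * r + s * (k * k)))
    collect a p m s k v r t n 2t = begin-equality
      a + p + (p * v + (k * r + s * t) + (p * p + m + s * t) + n * p) + 0  ≡⟨ left a p m s k v r t n ⟩
      rest + s * (2 * t)         ≡⟨ cong (λ z → rest + s * z) 2t ⟩
      rest + s * (k * suc k)     ≡⟨ right a p m s k v r n ⟩
      p * p + m + (a + s * k + n * p + (p * suc v + k * r + s * (k * k))) ∎
      where
      rest = a + p + p * v + k * r + p * p + m + n * p
      left : ∀ a p m s k v r t n → a + p + (p * v + (k * r + s * t) + (p * p + m + s * t) + n * p) + 0 ≡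
             a + p + p * v + k * r + p * p + m + n * p + s * (2 * t)
      left = solve-∀
      right : ∀ a p m s k v r n → a + p + p * v + k * r + p * p + m + n * p + s * (k * suc k) ≡
              p * p + m + (a + s * k + n * p + (p * suc v + k * r + s * (k * k)))
      right = solve-∀

  -- The estimate of `cut-middle` would here require nδ ≥ (δ + t)(δ + 1), which fails at n = δ + t +
  -- 1. A threshold one step below the top leaves an excess of only r, and the terms of `bs` cover
  -- it.
  cut-top : p ≡ δ + t → 1 ≤ t → sum as + p ≤ p * p + sum (map (_⊓ p) bs)
  cut-top p≡ 1≤t with m≤n⇒∃[o]m+o≡n 1≤t
  ... | c , t≡ = ≤-by 0
        (+-mono-≤ (+-mono-≤ (as-threshold c 1 (trans (sym t≡) (+-comm 1 c)))
                            (bs-bound δ ≤-refl (subst (δ ≤_) (sym p≡) (m≤m+n δ t))))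
                  (top-bound 1≤δ 1≤t (multiplicity≥2 1≤δ 1≤t r≤s wide) wide (trans n≡ (cong (_+ q) p≡))))
        (collect′ (sum as) p (sum (map (_⊓ p) bs)) s (δ + c) r (q * δ)
          (trans p≡ (trans (cong (δ +_) (sym t≡)) (+-suc δ c))))
    where
    collect : ∀ a m s v r b →
      a + suc v + (suc v * v + (1 * r + s * 1) + m + b) + 0 ≡ suc v * suc v + m + (a + s * 1 + b + r)
    collect = solve-∀
    collect′ : ∀ a p m s v r b → p ≡ suc v →
      a + p + (p * v + (1 * r + s * 1) + m + b) + 0 ≡ p * p + m + (a + s * 1 + b + r)
    collect′ a _ m s v r b refl = collect a m s v r b

  cut : sum as + p ≤ p * p + sum (map (_⊓ p) bs)
  cut with p ≤? δ | p ≤? δ + t * 1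
  ... | yes p≤δ | _ = cut-small (subst₂ (λ y z → δ + y < z) (sym (*-identityʳ t)) (sym (length-stair δ 1 t s r)) wide) p≤δ
  ... | no  p≰δ | no p≰Δ = cut-large (≰⇒> p≰Δ)
  ... | no  p≰δ | yes p≤Δ with m≤n⇒∃[o]m+o≡n (<⇒≤ (≰⇒> p≰δ))
  ...   | k , δ+k≡p with m≤n⇒∃[o]m+o≡n (+-cancelˡ-≤ δ k t
                           (subst₂ _≤_ (sym δ+k≡p) (cong (δ +_) (*-identityʳ t)) p≤Δ))
  ...     | suc c , k+c≡t = cut-middle k c (sym k+c≡t) (sym δ+k≡p)
  ...     | zero  , k+0≡t = cut-top (trans (sym δ+k≡p) (cong (δ +_) k≡t)) (+-cancelˡ-< δ 0 t
                              (subst₂ _<_ (sym (+-identityʳ δ)) (trans (sym δ+k≡p) (cong (δ +_) k≡t)) (≰⇒> p≰δ)))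
    where
    k≡t : k ≡ t
    k≡t = trans (sym (+-identityʳ k)) k+0≡t

erdősGallai-stair : ∀ {δ t s r} → 1 ≤ δ → r ≤ s → δ + t < t * s + r → ErdősGallaiList (stair δ 1 t s r)
erdősGallai-stair 1≤δ r≤s wide as bs perm = Middle.cut 1≤δ r≤s wide as bs perm

-- Spread and windows of degrees

maximum-upper : ∀ xs → All (_≤ maximum xs) xs
maximum-upper []       = []
maximum-upper (x ∷ xs) = ⊥≤max x xs ∷ xs≤max x xs

maximum-least : ∀ {c xs} → All (_≤ c) xs → maximum xs ≤ c
maximum-least []           = z≤n
maximum-least (x≤c ∷ xs≤c) = max≤v⁺ x≤c xs≤c

minimum-lower : ∀ xs → All (minimum xs ≤_) xs
minimum-lower []       = []
minimum-lower (x ∷ xs) = min≤⊤ x xs ∷ min≤xs x xs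

minimum-greatest : ∀ {c x xs} → All (c ≤_) (x ∷ xs) → c ≤ minimum (x ∷ xs)
minimum-greatest (c≤x ∷ c≤xs) = v≤min⁺ c≤x c≤xs

module _ (k : ℕ) where

  InWindow : ℕ → ℕ → Set
  InWindow v d = v ≤ d × d ≤ v + k

  inWindow? : ∀ v d → Dec (InWindow v d)
  inWindow? v d = (v ≤? d) ×-dec (d ≤? v + k)

  count : ℕ → List ℕ → ℕ
  count v xs = length (filter (inWindow? v) xs)

  count-++ : ∀ v xs ys → count v (xs ++ ys) ≡ count v xs + count v ys
  count-++ v xs ys = trans (cong length (filter-++ (inWindow? v) xs ys)) (length-++ (filter (inWindow? v) xs))

  count-↭ : ∀ v {xs ys} → xs ↭ ys → count v xs ≡ count v ys
  count-↭ v p = ↭-length (filter-↭ (inWindow? v) p)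

  count-all : ∀ v {xs} → All (InWindow v) xs → count v xs ≡ length xs
  count-all v all = cong length (filter-all (inWindow? v) all)

  count-none : ∀ v {xs} → All (λ d → ¬ InWindow v d) xs → count v xs ≡ 0
  count-none v none = cong length (filter-none (inWindow? v) none)

∈-subsets : ∀ {n} (B : Subset n) → B List.∈ subsets n
∈-subsets Vec.[]          = here refl
∈-subsets (inside  Vec.∷ B) = ∈-++⁺ˡ (∈-map⁺ (inside Vec.∷_) (∈-subsets B))
∈-subsets {suc n} (outside Vec.∷ B) = ∈-++⁺ʳ (map (inside Vec.∷_) (subsets n)) (∈-map⁺ (outside Vec.∷_) (∈-subsets B))

∣∣≡∑ : ∀ {n} (B : Subset n) → ∣ B ∣ ≡ ∑ (λ u → ⟦ does (u ∈? B) ⟧)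
∣∣≡∑ Vec.[]              = refl
∣∣≡∑ (inside  Vec.∷ B) = cong suc (∣∣≡∑ B)
∣∣≡∑ (outside Vec.∷ B) = ∣∣≡∑ B

does-true : ∀ {X : Set} (X? : Dec X) → does X? ≡ true → X
does-true (yes x) _ = x

module _ {n} (G : Graph n) (k : ℕ) where

  count-degrees : ∀ v → count k v (degrees G) ≡ ∑ (λ u → ⟦ does (inWindow? k v (deg G u)) ⟧)
  count-degrees v = trans (cong (count k v) (map-tabulate id (deg G))) (length-filter-tabulate (inWindow? k v) (deg G))

  -- The vertices whose degrees lie in the window form a set of spread at most `k`.
  count≤sp : ∀ v → count k v (degrees G) ≤ sp G k
  count≤sp v = subst (_≤ sp G k) ∣B∣≡ (All.lookup (maximum-upper _)
    (∈-map⁺ ∣_∣ (∈-filter⁺ (λ B → spread G B ≤? k) (∈-subsets B) narrow)))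
    where
    within : Fin n → Bool
    within u = does (inWindow? k v (deg G u))

    B : Subset n
    B = Vec.tabulate within

    ∣B∣≡ : ∣ B ∣ ≡ count k v (degrees G)
    ∣B∣≡ = trans (∣tabulate∣ within) (sym (count-degrees v))

    window : ∀ {u} → u ∈ B → InWindow k v (deg G u)
    window {u} u∈B = does-true (inWindow? k v (deg G u)) (trans (sym (lookup∘tabulate within u)) ([]=⇒lookup u∈B))

    spread≤ : ∀ {xs} → All (InWindow k v) xs → maximum xs ∸ minimum xs ≤ k
    spread≤ []           = z≤n
    spread≤ all@(_ ∷ _) = m≤n+o⇒m∸n≤o _ _ (≤-trans (maximum-least (All.map proj₂ all))
                                                (+-monoˡ-≤ k (minimum-greatest (All.map proj₁ all))))

    narrow : spread G B ≤ k
    narrow = spread≤ (All.map⁺ (All.map window (All.all-filter (_∈? B) (allFin n))))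

  -- Conversely, a set of spread at most `k` lies in the window that starts at its least degree.
  sp≤ : ∀ {σ} → (∀ v → count k v (degrees G) ≤ σ) → sp G k ≤ σ
  sp≤ {σ} bound = maximum-least (All.map⁺ (All.map small (All.all-filter (λ B → spread G B ≤? k) (subsets n))))
    where
    small : ∀ {B} → spread G B ≤ k → ∣ B ∣ ≤ σ
    small {B} narrow = begin
      ∣ B ∣                                             ≡⟨ ∣∣≡∑ B ⟩
      ∑ (λ u → ⟦ does (u ∈? B) ⟧)                       ≤⟨ ∑-mono-≤ (λ u → ⟦⟧-mono λ z →
                                                             dec-true (inWindow? k v (deg G u)) (window (does-true (u ∈? B) z))) ⟩
      ∑ (λ u → ⟦ does (inWindow? k v (deg G u)) ⟧)      ≡⟨ count-degrees v ⟨
      count k v (degrees G)                             ≤⟨ bound v ⟩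
      σ                                                 ∎
      where
      open ≤-Reasoning
      v = minimum (degreesIn G B)

      window : ∀ {u} → u ∈ B → InWindow k v (deg G u)
      window {u} u∈B = All.lookup (minimum-lower _) du , ≤-trans (All.lookup (maximum-upper _) du) (≤-trans (m≤n+m∸n _ v) (+-monoʳ-≤ v narrow))
        where
        du : deg G u List.∈ degreesIn G B
        du = ∈-map⁺ (deg G) (∈-filter⁺ (_∈? B) (∈-allFin u) u∈B)

beyond-window : ∀ k {v δ d} → v ≤ δ → δ + suc k ≤ d → ¬ InWindow k v d
beyond-window k {v} {δ} {d} v≤δ δ+h≤d (_ , d≤v+k) = <⇒≱ d<δ+h δ+h≤d
  where
  d<δ+h : d < δ + suc k
  d<δ+h = ≤-trans (s≤s (≤-trans d≤v+k (+-monoˡ-≤ k v≤δ))) (≤-reflexive (sym (+-suc δ k)))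

-- Distinct values of the staircase are at least k + 1 apart, so a window meets at most one block,
-- and no block has more than s terms.
count-stair≤ : ∀ k δ t {s r} → r ≤ s → ∀ v → count k v (stair δ (suc k) t s r) ≤ s
count-stair≤ k δ zero {s} {r} r≤s v =
  ≤-trans (length-filter (inWindow? k v) (replicate r δ)) (≤-trans (≤-reflexive (length-replicate r)) r≤s)
count-stair≤ k δ (suc t) {s} {r} r≤s v rewrite count-++ k v (replicate s δ) (stair (δ + suc k) (suc k) t s r)
  with inWindow? k v δ
... | no ∉ rewrite count-none k v (All.replicate⁺ {P = λ d → ¬ InWindow k v d} s ∉) = count-stair≤ k (δ + suc k) t r≤s v
... | yes (v≤δ , _) rewrite count-none k v {stair (δ + suc k) (suc k) t s r} (All.map (beyond-window k v≤δ) (stair-≥ (δ + suc k) (suc k) t s r)) =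
  ≤-trans (≤-reflexive (+-identityʳ _)) (≤-trans (length-filter (inWindow? k v) (replicate s δ)) (≤-reflexive (length-replicate s)))

count-stair-min : ∀ k δ t s r → s ≤ count k δ (stair δ (suc k) (suc t) s r)
count-stair-min k δ t s r = begin
  s                                                    ≡⟨ length-replicate s ⟨
  length (replicate s δ)                               ≡⟨ count-all k δ (All.replicate⁺ s (≤-refl , m≤m+n δ k)) ⟨
  count k δ (replicate s δ)                            ≤⟨ m≤m+n _ _ ⟩
  count k δ (replicate s δ) + count k δ (stair (δ + suc k) (suc k) t s r)  ≡⟨ count-++ k δ (replicate s δ) _ ⟨
  count k δ (stair δ (suc k) (suc t) s r)              ∎
  where open ≤-Reasoning

sp-stair : ∀ {n} (G : Graph n) k δ t s r → r ≤ s → degrees G ↭ stair δ (suc k) (suc t) s r → sp G k ≡ s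
sp-stair G k δ t s r r≤s perm = ≤-antisym
  (sp≤ G k λ v → ≤-trans (≤-reflexive (count-↭ k v perm)) (count-stair≤ k δ (suc t) r≤s v))
  (≤-trans (count-stair-min k δ t s r) (≤-trans (≤-reflexive (count-↭ k δ (↭-sym perm))) (count≤sp G k δ)))

-- Lower bound for the degree sum and its equality case.

split-at : ∀ c xs → ∃[ ys ] ∃[ zs ] (xs ↭ ys ++ zs) × All (_< c) ys × All (c ≤_) zs
split-at c []       = [] , [] , ↭-refl , [] , []
split-at c (x ∷ xs) with split-at c xs | x <? c
... | ys , zs , perm , ys<c , c≤zs | yes x<c = x ∷ ys , zs , prep x perm , x<c ∷ ys<c , c≤zs
... | ys , zs , perm , ys<c , c≤zs | no  x≮c =
  ys , x ∷ zs , ↭-trans (prep x perm) (↭-sym (shift x ys zs)) , ys<c , ≮⇒≥ x≮c ∷ c≤zs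

-- The equality case of `length*≤sum`.
constant : ∀ {c xs} → All (c ≤_) xs → sum xs ≤ length xs * c → xs ≡ replicate (length xs) c
constant [] _ = refl
constant {c} {x ∷ xs} (c≤x ∷ c≤xs) sum≤ = cong₂ _∷_
  (≤-antisym (+-cancelʳ-≤ (length xs * c) x c (≤-trans (+-monoʳ-≤ x (length*≤sum c≤xs)) sum≤)) c≤x)
  (constant c≤xs (+-cancelˡ-≤ c (sum xs) (length xs * c) (≤-trans (+-monoˡ-≤ (sum xs) c≤x) sum≤)))

module _ (k σ : ℕ) where

  private
    h = suc k

  Narrow : List ℕ → Set
  Narrow xs = ∀ v → count k v xs ≤ σ

  record Layer (δ : ℕ) (xs : List ℕ) : Set where
    field
      {ys zs}  : List ℕ
      perm     : xs ↭ ys ++ zs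
      ys≥      : All (δ ≤_) ys
      zs≥      : All (δ + h ≤_) zs
      ∣ys∣≤    : length ys ≤ σ
      narrow′  : Narrow zs

    length≡ : length xs ≡ length ys + length zs
    length≡ = trans (↭-length perm) (length-++ ys)

    sum≡ : sum xs ≡ sum ys + sum zs
    sum≡ = trans (sum-↭ perm) (sum-++ ys zs)

  -- The entries below δ + h all lie in the window at δ, hence number at most σ; the others inherit
  -- narrowness, which makes induction on `t` possible.
  layer : ∀ {δ xs} → All (δ ≤_) xs → Narrow xs → Layer δ xs
  layer {δ} {xs} lower narrow with split-at (δ + h) xs
  ... | ys , zs , perm , ys< , zs≥ = record
    { perm    = perm
    ; ys≥     = ys≥
    ; zs≥     = zs≥
    ; ∣ys∣≤   = begin
        length ys                  ≡⟨ count-all k δ window ⟨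
        count k δ ys               ≤⟨ m≤m+n _ _ ⟩
        count k δ ys + count k δ zs  ≤⟨ total δ ⟩
        σ                          ∎
    ; narrow′ = λ v → ≤-trans (m≤n+m _ _) (total v)
    }
    where
    open ≤-Reasoning
    ys≥ : All (δ ≤_) ys
    ys≥ = All.++⁻ˡ ys (All-resp-↭ perm lower)

    window : All (InWindow k δ) ys
    window = All.zipWith (λ (δ≤y , y<) → δ≤y , s≤s⁻¹ (≤-trans y< (≤-reflexive (+-suc δ k)))) (ys≥ , ys<)

    total : ∀ v → count k v ys + count k v zs ≤ σ
    total v = ≤-trans (≤-reflexive (trans (sym (count-++ k v ys zs)) (count-↭ k v (↭-sym perm)))) (narrow v)

  sum-bound : ∀ δ t xs → All (δ ≤_) xs → Narrow xs → length xs * (δ + t * h) ≤ sum xs + h * σ * tri t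
  sum-bound δ zero xs lower narrow =
    ≤-trans (≤-reflexive (cong (length xs *_) (+-identityʳ δ))) (≤-trans (length*≤sum lower) (m≤m+n _ _))
  sum-bound δ (suc t) xs lower narrow =
    subst₂ (λ l m → l * (δ + suc t * h) ≤ m + h * σ * tri (suc t)) (sym length≡) (sym sum≡)
      (≤-by 0 (+-mono-≤ (+-mono-≤ (sum-bound (δ + h) t zs zs≥ narrow′) (length*≤sum ys≥))
                        (*-monoʳ-≤ (suc t * h) ∣ys∣≤))
              (collect (length ys) (length zs) (sum ys) (sum zs) δ t h σ (tri t)))
    where
    open Layer (layer lower narrow)
    collect : ∀ y z Y Z δ t h σ T →
      (y + z) * (δ + suc t * h) + (Z + h * σ * T + Y + suc t * h * σ) + 0 ≡
      Y + Z + h * σ * (suc t + T) + (z * (δ + h + t * h) + y * δ + suc t * h * y)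
    collect = solve-∀

  -- `sum-bound` adds three inequalities: the bound for `zs`, the bound δ for the entries of `ys`,
  -- and |ys| ≤ σ. With a tight total none can be strict, so each is reversed by adding `tight′` to
  -- the other two.
  sum-bound-tight : ∀ δ t xs → All (δ ≤_) xs → Narrow xs → sum xs + h * σ * tri t ≤ length xs * (δ + t * h) →
                    ∃[ r ] r ≤ σ × xs ↭ stair δ h t σ r
  sum-bound-tight δ zero xs lower narrow tight = length xs , ∣xs∣≤σ , ↭-reflexive xs≡
    where
    xs≡ : xs ≡ replicate (length xs) δ
    xs≡ = constant lower (≤-trans (m≤m+n _ _) (≤-trans tight (≤-reflexive (cong (length xs *_) (+-identityʳ δ)))))

    -- What remains after all layers is a constant block inside a single window; this bounds the
    -- multiplicity of the top term.
    ∣xs∣≤σ : length xs ≤ σ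
    ∣xs∣≤σ = subst (_≤ σ) (count-all k δ (subst (All (InWindow k δ)) (sym xs≡)
                   (All.replicate⁺ (length xs) (≤-refl , m≤m+n δ k)))) (narrow δ)
  sum-bound-tight δ (suc t) xs lower narrow tight = finish (sum-bound-tight (δ + h) t zs zs≥ narrow′ zs-tight)
    where
    open Layer (layer lower narrow)
    y = length ys
    z = length zs

    bound-zs = sum-bound (δ + h) t zs zs≥ narrow′
    bound-ys = length*≤sum ys≥
    bound-∣ys∣ = *-monoʳ-≤ (suc t * h) ∣ys∣≤

    tight′ : sum ys + sum zs + h * σ * tri (suc t) ≤ (y + z) * (δ + suc t * h)
    tight′ = subst₂ (λ l m → m + h * σ * tri (suc t) ≤ l * (δ + suc t * h)) length≡ sum≡ tight

    zs-tight : sum zs + h * σ * tri t ≤ z * (δ + h + t * h)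
    zs-tight = ≤-by 0 (+-mono-≤ (+-mono-≤ tight′ bound-ys) bound-∣ys∣)
      (collect y z (sum ys) (sum zs) δ t h σ (tri t))
      where
      collect : ∀ y z Y Z δ t h σ T →
        Z + h * σ * T + ((y + z) * (δ + suc t * h) + Y + suc t * h * σ) + 0 ≡
        z * (δ + h + t * h) + (Y + Z + h * σ * (suc t + T) + y * δ + suc t * h * y)
      collect = solve-∀

    ys-tight : sum ys ≤ y * δ
    ys-tight = ≤-by 0 (+-mono-≤ (+-mono-≤ tight′ bound-zs) bound-∣ys∣)
      (collect y z (sum ys) (sum zs) δ t h σ (tri t))
      where
      collect : ∀ y z Y Z δ t h σ T →
        Y + ((y + z) * (δ + suc t * h) + (Z + h * σ * T) + suc t * h * σ) + 0 ≡
        y * δ + (Y + Z + h * σ * (suc t + T) + z * (δ + h + t * h) + suc t * h * y)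
      collect = solve-∀

    σ≤y : σ ≤ y
    σ≤y = *-cancelˡ-≤ (suc t * h) (≤-by 0 (+-mono-≤ (+-mono-≤ tight′ bound-zs) bound-ys)
      (collect y z (sum ys) (sum zs) δ t h σ (tri t)))
      where
      collect : ∀ y z Y Z δ t h σ T →
        suc t * h * σ + ((y + z) * (δ + suc t * h) + (Z + h * σ * T) + Y) + 0 ≡
        suc t * h * y + (Y + Z + h * σ * (suc t + T) + z * (δ + h + t * h) + y * δ)
      collect = solve-∀

    ys≡ : ys ≡ replicate σ δ
    ys≡ = trans (constant ys≥ ys-tight) (cong (λ l → replicate l δ) (≤-antisym ∣ys∣≤ σ≤y))

    finish : ∃[ r ] r ≤ σ × zs ↭ stair (δ + h) h t σ r → ∃[ r ] r ≤ σ × xs ↭ stair δ h (suc t) σ r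
    finish (r , r≤σ , zs↭) = r , r≤σ , ↭-trans perm (++⁺ (↭-reflexive ys≡) zs↭)

-- Clearing denominators

open import Data.Integer using (+_)
import Data.Integer as ℤ
import Data.Integer.Properties as ℤ
import Data.Integer.Tactic.RingSolver as ℤ-Solver
open import Data.Rational as ℚ using (_/_; toℚᵘ)
import Data.Rational.Properties as ℚ
open import Data.Rational.Unnormalised as ℚᵘ using (mkℚᵘ; *≡*; *≤*)
import Data.Rational.Unnormalised.Properties as ℚᵘ

-- Fractions in ℚ are reduced; the unnormalised ones keep numerator and denominator as given, so
-- comparing them is cross-multiplication.
toℚᵘ-/ : ∀ i d .{{_ : NonZero d}} → toℚᵘ (i / d) ℚᵘ.≃ i ℚᵘ./ d
toℚᵘ-/ i (suc d) = ℚ.toℚᵘ-fromℚᵘ (mkℚᵘ i d)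

cross-≤ : ∀ a b c d .{{_ : NonZero b}} .{{_ : NonZero d}} → + a / b ℚ.≤ + c / d → a * d ≤ c * b
cross-≤ a b@(suc _) c d@(suc _) le = ℤ.drop‿+≤+ (subst₂ ℤ._≤_ (sym (ℤ.pos-* a d)) (sym (ℤ.pos-* c b))
  (ℚᵘ.drop-*≤* (ℚᵘ.≤-respˡ-≃ (toℚᵘ-/ (+ a) b) (ℚᵘ.≤-respʳ-≃ (toℚᵘ-/ (+ c) d) (ℚ.toℚᵘ-mono-≤ le)))))

uncross-≤ : ∀ a b c d .{{_ : NonZero b}} .{{_ : NonZero d}} → a * d ≤ c * b → + a / b ℚ.≤ + c / d
uncross-≤ a b@(suc _) c d@(suc _) le = ℚ.toℚᵘ-cancel-≤ (ℚᵘ.≤-respˡ-≃ (ℚᵘ.≃-sym (toℚᵘ-/ (+ a) b))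
  (ℚᵘ.≤-respʳ-≃ (ℚᵘ.≃-sym (toℚᵘ-/ (+ c) d)) (*≤* (subst₂ ℤ._≤_ (ℤ.pos-* a d) (ℤ.pos-* c b) (ℤ.+≤+ le)))))

cross-≡ : ∀ i b j d .{{_ : NonZero b}} .{{_ : NonZero d}} → i / b ≡ j / d → i ℤ.* + d ≡ j ℤ.* + b
cross-≡ i b@(suc _) j d@(suc _) eq =
  ℚᵘ.drop-*≡* (ℚᵘ.≃-trans (ℚᵘ.≃-sym (toℚᵘ-/ i b)) (ℚᵘ.≃-trans (ℚ.toℚᵘ-cong eq) (toℚᵘ-/ j d)))

uncross-≡ : ∀ i b j d .{{_ : NonZero b}} .{{_ : NonZero d}} → i ℤ.* + d ≡ j ℤ.* + b → i / b ≡ j / d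
uncross-≡ i (suc b) j (suc d) eq = ℚ.fromℚᵘ-cong {mkℚᵘ i b} {mkℚᵘ j d} (*≡* eq)

toℚᵘ-difference : ∀ y z → toℚᵘ (+ y / 1 ℚ.- + z / 2) ℚᵘ.≃ mkℚᵘ (+ y) 0 ℚᵘ.- mkℚᵘ (+ z) 1
toℚᵘ-difference y z = ℚᵘ.≃-trans (ℚ.toℚᵘ-homo-+ (+ y / 1) (ℚ.- (+ z / 2)))
  (ℚᵘ.+-cong (toℚᵘ-/ (+ y) 1) (ℚᵘ.≃-trans (ℚ.toℚᵘ-homo‿- (+ z / 2)) (ℚᵘ.-‿cong (toℚᵘ-/ (+ z) 2))))

pos-double+ : ∀ x z → + (2 * x + z) ≡ + 2 ℤ.* + x ℤ.+ + z
pos-double+ x z = trans (ℤ.pos-+ (2 * x) z) (cong (ℤ._+ + z) (ℤ.pos-* 2 x))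

half-difference⇒ : ∀ x y z → + x / 1 ≡ + y / 1 ℚ.- + z / 2 → 2 * x + z ≡ 2 * y
half-difference⇒ x y z eq = ℤ.+-injective (begin
  + (2 * x + z)                                                   ≡⟨ pos-double+ x z ⟩
  + 2 ℤ.* + x ℤ.+ + z                                             ≡⟨ cong (ℤ._+ + z) (ℤ.*-comm (+ 2) (+ x)) ⟩
  + x ℤ.* + 2 ℤ.+ + z                                             ≡⟨ cong (ℤ._+ + z) cross ⟩
  (+ y ℤ.* + 2 ℤ.+ ℤ.- + z ℤ.* + 1) ℤ.* + 1 ℤ.+ + z               ≡⟨ cancel (+ y) (+ z) ⟩
  + 2 ℤ.* + y                                                     ≡⟨ ℤ.pos-* 2 y ⟨
  + (2 * y)                                                       ∎)
  where
  open ≡-Reasoning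
  cross : + x ℤ.* + 2 ≡ (+ y ℤ.* + 2 ℤ.+ ℤ.- + z ℤ.* + 1) ℤ.* + 1
  cross = ℚᵘ.drop-*≡* (ℚᵘ.≃-trans (ℚᵘ.≃-sym (toℚᵘ-/ (+ x) 1)) (ℚᵘ.≃-trans (ℚ.toℚᵘ-cong eq) (toℚᵘ-difference y z)))
  cancel : ∀ y z → (y ℤ.* + 2 ℤ.+ ℤ.- z ℤ.* + 1) ℤ.* + 1 ℤ.+ z ≡ + 2 ℤ.* y
  cancel = ℤ-Solver.solve-∀

half-difference⇐ : ∀ x y z → 2 * x + z ≡ 2 * y → + x / 1 ≡ + y / 1 ℚ.- + z / 2
half-difference⇐ x y z eq = ℚ.toℚᵘ-injective (ℚᵘ.≃-trans (toℚᵘ-/ (+ x) 1) (ℚᵘ.≃-trans (*≡* cross) (ℚᵘ.≃-sym (toℚᵘ-difference y z))))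
  where
  open ≡-Reasoning
  expand : ∀ x z → x ℤ.* + 2 ≡ (+ 2 ℤ.* x ℤ.+ z) ℤ.- z
  expand = ℤ-Solver.solve-∀
  collect : ∀ y z → + 2 ℤ.* y ℤ.- z ≡ (y ℤ.* + 2 ℤ.+ ℤ.- z ℤ.* + 1) ℤ.* + 1
  collect = ℤ-Solver.solve-∀
  cross : + x ℤ.* + 2 ≡ (+ y ℤ.* + 2 ℤ.+ ℤ.- + z ℤ.* + 1) ℤ.* + 1
  cross = begin
    + x ℤ.* + 2                                       ≡⟨ expand (+ x) (+ z) ⟩
    (+ 2 ℤ.* + x ℤ.+ + z) ℤ.- + z                     ≡⟨ cong (ℤ._- + z) (pos-double+ x z) ⟨
    + (2 * x + z) ℤ.- + z                             ≡⟨ cong (λ w → + w ℤ.- + z) eq ⟩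
    + (2 * y) ℤ.- + z                                 ≡⟨ cong (ℤ._- + z) (ℤ.pos-* 2 y) ⟩
    + 2 ℤ.* + y ℤ.- + z                               ≡⟨ collect (+ y) (+ z) ⟩
    (+ y ℤ.* + 2 ℤ.+ ℤ.- + z ℤ.* + 1) ℤ.* + 1         ∎

pos-*+double : ∀ σ D b → + (σ * D + 2 * b) ≡ + σ ℤ.* + D ℤ.+ + 2 ℤ.* + b
pos-*+double σ D b = trans (ℤ.pos-+ (σ * D) (2 * b)) (cong₂ ℤ._+_ (ℤ.pos-* σ D) (ℤ.pos-* 2 b))

-- Moving 2b to the other side removes the integer subtraction in `f`, and the rest of the argument
-- stays in ℕ.
double-quotient⇒ : ∀ σ a b D .{{_ : NonZero D}} → + σ / 1 ≡ (+ 2 ℤ.* (+ a ℤ.- + b)) / D → σ * D + 2 * b ≡ 2 * a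
double-quotient⇒ σ a b D eq = ℤ.+-injective (begin
  + (σ * D + 2 * b)                                 ≡⟨ pos-*+double σ D b ⟩
  + σ ℤ.* + D ℤ.+ + 2 ℤ.* + b                       ≡⟨ cong (ℤ._+ + 2 ℤ.* + b) (cross-≡ (+ σ) 1 (+ 2 ℤ.* (+ a ℤ.- + b)) D eq) ⟩
  (+ 2 ℤ.* (+ a ℤ.- + b)) ℤ.* + 1 ℤ.+ + 2 ℤ.* + b   ≡⟨ cancel (+ a) (+ b) ⟩
  + 2 ℤ.* + a                                       ≡⟨ ℤ.pos-* 2 a ⟨
  + (2 * a)                                         ∎)
  where
  open ≡-Reasoning
  cancel : ∀ a b → (+ 2 ℤ.* (a ℤ.- b)) ℤ.* + 1 ℤ.+ + 2 ℤ.* b ≡ + 2 ℤ.* a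
  cancel = ℤ-Solver.solve-∀

double-quotient⇐ : ∀ σ a b D .{{_ : NonZero D}} → σ * D + 2 * b ≡ 2 * a → + σ / 1 ≡ (+ 2 ℤ.* (+ a ℤ.- + b)) / D
double-quotient⇐ σ a b D eq = uncross-≡ (+ σ) 1 (+ 2 ℤ.* (+ a ℤ.- + b)) D (begin
  + σ ℤ.* + D                                       ≡⟨ expand (+ σ ℤ.* + D) (+ b) ⟩
  (+ σ ℤ.* + D ℤ.+ + 2 ℤ.* + b) ℤ.- + 2 ℤ.* + b     ≡⟨ cong (ℤ._- + 2 ℤ.* + b) (pos-*+double σ D b) ⟨
  + (σ * D + 2 * b) ℤ.- + 2 ℤ.* + b                 ≡⟨ cong (λ w → + w ℤ.- + 2 ℤ.* + b) eq ⟩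
  + (2 * a) ℤ.- + 2 ℤ.* + b                         ≡⟨ cong (ℤ._- + 2 ℤ.* + b) (ℤ.pos-* 2 a) ⟩
  + 2 ℤ.* + a ℤ.- + 2 ℤ.* + b                       ≡⟨ collect (+ a) (+ b) ⟩
  (+ 2 ℤ.* (+ a ℤ.- + b)) ℤ.* + 1                   ∎)
  where
  open ≡-Reasoning
  expand : ∀ x b → x ≡ (x ℤ.+ + 2 ℤ.* b) ℤ.- + 2 ℤ.* b
  expand = ℤ-Solver.solve-∀
  collect : ∀ a b → + 2 ℤ.* a ℤ.- + 2 ℤ.* b ≡ (+ 2 ℤ.* (a ℤ.- b)) ℤ.* + 1
  collect = ℤ-Solver.solve-∀

-- Extremal graphs

∑-1 : ∀ n → ∑ {n} (λ _ → 1) ≡ n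
∑-1 zero    = refl
∑-1 (suc n) = cong suc (∑-1 n)

-- The row of `u` has entries at most 1 and a zero on the diagonal.
deg< : ∀ {n} (G : Graph n) u → deg G u < n
deg< {n} G u = subst₂ _<_ (sym (deg≡∑ G u)) (∑-1 n)
  (∑-mono-< (λ v → ⟦⟧≤1 (adj G u v)) u (subst (λ b → ⟦ b ⟧ < 1) (sym (irrefl G u)) (s≤s z≤n)))
  where
  ⟦⟧≤1 : ∀ b → ⟦ b ⟧ ≤ 1
  ⟦⟧≤1 true  = ≤-refl
  ⟦⟧≤1 false = z≤n

length-degrees : ∀ {n} (G : Graph n) → length (degrees G) ≡ n
length-degrees {n} G = trans (length-map (deg G) (allFin n)) (length-tabulate id)

minimum-unique : ∀ {c xs} → All (c ≤_) xs → c List.∈ xs → minimum xs ≡ c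
minimum-unique {xs = x ∷ xs} lower c∈ = ≤-antisym (All.lookup (minimum-lower (x ∷ xs)) c∈) (minimum-greatest lower)

graphic⇒maximum< : ∀ {xs} → 1 ≤ length xs → Graphic xs → maximum xs < length xs
graphic⇒maximum< {xs@(_ ∷ _)} _ (n , G , perm) = s≤s (maximum-least (All.map s≤s⁻¹ (subst (λ l → All (_< l) xs) n≡
  (All-resp-↭ perm (All.map⁺ (All.universal (deg< G) (allFin n)))))))
  where
  n≡ : n ≡ length xs
  n≡ = trans (sym (length-degrees G)) (↭-length perm)

bottom∈stair : ∀ {δ h t s r} → 1 ≤ s → δ List.∈ stair δ h (suc t) s r
bottom∈stair {s = suc s} _ = here refl

top∈stair : ∀ δ h t {s r} → 1 ≤ r → δ + t * h List.∈ stair δ h t s r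
top∈stair δ h zero    {r = suc r} _ = here (+-identityʳ δ)
top∈stair δ h (suc t) {s} {r} 1≤r = ∈-++⁺ʳ (replicate s δ)
  (subst (List._∈ stair (δ + h) h t s r) (+-assoc δ h (t * h)) (top∈stair (δ + h) h t 1≤r))

sum-replicate : ∀ r x → sum (replicate r x) ≡ r * x
sum-replicate zero    x = refl
sum-replicate (suc r) x = cong (λ z → x + z) (sum-replicate r x)

-- The staircase attains `sum-bound` with σ = s.
sum-stair : ∀ δ h t s r → sum (stair δ h t s r) + h * s * tri t ≡ (t * s + r) * (δ + t * h)
sum-stair δ h zero s r rewrite sum-replicate r δ = collect δ h s r
  where collect : ∀ δ h s r → r * δ + h * s * 0 ≡ r * (δ + 0)
        collect = solve-∀
sum-stair δ h (suc t) s r rewrite sum-++ (replicate s δ) (stair (δ + h) h t s r) | sum-replicate s δ = begin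
  s * δ + Y + h * s * (suc t + tri t)                    ≡⟨ expand δ h t s Y (tri t) ⟩
  s * δ + (Y + h * s * tri t) + h * s * suc t            ≡⟨ cong (λ z → s * δ + z + h * s * suc t) (sum-stair (δ + h) h t s r) ⟩
  s * δ + (t * s + r) * (δ + h + t * h) + h * s * suc t  ≡⟨ collect δ h t s r ⟩
  (s + t * s + r) * (δ + (h + t * h))                    ∎
  where
  open ≡-Reasoning
  Y = sum (stair (δ + h) h t s r)
  expand : ∀ δ h t s Y T → s * δ + Y + h * s * (suc t + T) ≡ s * δ + (Y + h * s * T) + h * s * suc t
  expand = solve-∀
  collect : ∀ δ h t s r → s * δ + (t * s + r) * (δ + h + t * h) + h * s * suc t ≡ (s + t * s + r) * (δ + (h + t * h))
  collect = solve-∀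

tri-double : ∀ h s t → s * h * t * suc t ≡ 2 * (h * s * tri t)
tri-double h s t = begin
  s * h * t * suc t      ≡⟨ left h s t ⟩
  h * s * (t * suc t)    ≡⟨ cong (h * s *_) (2*tri t) ⟨
  h * s * (2 * tri t)    ≡⟨ right h s (tri t) ⟩
  2 * (h * s * tri t)    ∎
  where
  open ≡-Reasoning
  left : ∀ h s t → s * h * t * suc t ≡ h * s * (t * suc t)
  left = solve-∀
  right : ∀ h s T → h * s * (2 * T) ≡ 2 * (h * s * T)
  right = solve-∀

-- Admissibility cleared of denominators, with r the multiplicity of the largest term of P.
record Balanced (δ h t n m s r : ℕ) : Set where
  constructor balanced
  field
    order  : t * s + r ≡ n
    r≤s    : r ≤ s
    weight : 2 * m + h * s * tri t ≡ n * (δ + t * h)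

  P≡ : P δ h t n s ≡ stair δ h t s r
  P≡ = trans (P≡stair δ h t n s) (cong (stair δ h t s) (trans (cong (_∸ t * s) (sym order)) (m+n∸m≡n (t * s) r)))

  length≡ : length (stair δ h t s r) ≡ n
  length≡ = trans (length-stair δ h t s r) order

  sum≡ : sum (stair δ h t s r) ≡ 2 * m
  sum≡ = +-cancelʳ-≡ (h * s * tri t) _ _
    (trans (sum-stair δ h t s r) (trans (cong (_* (δ + t * h)) order) (sym weight)))

  -- If s = 0, then r = 0 and hence n = 0.
  positive : 2 ≤ n → 1 ≤ s
  positive 2≤n = n≢0⇒n>0 λ { refl → contradiction (subst (2 ≤_) (trans (sym order) (cong₂ _+_ (*-zeroʳ t) (n≤0⇒n≡0 r≤s))) 2≤n) λ () }

module _ {δ h t n m s : ℕ} .{{_ : NonZero t}} where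

  admissible⇒ : Admissible δ h t n m s → Balanced δ h t n m s (n ∸ t * s)
  admissible⇒ (n≤ , s≤ , weight) = balanced (m+[n∸m]≡n ts≤n) r≤s (*-cancelˡ-≡ _ _ 2 weight′)
    where
    ts≤n : t * s ≤ n
    ts≤n = subst₂ _≤_ (*-comm s t) (*-identityʳ n) (cross-≤ s 1 n t s≤)

    r≤s : n ∸ t * s ≤ s
    r≤s = m≤n+o⇒m∸n≤o n (t * s) (≤-trans (subst (_≤ s * suc t) (*-identityʳ n) (cross-≤ n (suc t) s 1 n≤))
            (≤-reflexive (trans (*-comm s (suc t)) (+-comm s (t * s)))))

    weight′ : 2 * (2 * m + h * s * tri t) ≡ 2 * (n * (δ + t * h))
    weight′ = trans (*-distribˡ-+ 2 (2 * m) _) (trans (cong (λ z → 2 * (2 * m) + z) (sym (tri-double h s t)))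
                (half-difference⇒ (2 * m) (n * (δ + t * h)) (s * h * t * suc t) weight))

  admissible⇐ : ∀ {r} → Balanced δ h t n m s r → Admissible δ h t n m s
  admissible⇐ {r} (balanced order r≤s weight) =
    uncross-≤ n (suc t) s 1 (≤-trans (≤-reflexive (trans (*-identityʳ n) (sym order)))
      (≤-trans (+-monoʳ-≤ (t * s) r≤s) (≤-reflexive (trans (+-comm (t * s) s) (*-comm (suc t) s))))) ,
    uncross-≤ s 1 n t (≤-trans (≤-reflexive (*-comm s t)) (≤-trans (m≤m+n (t * s) r) (≤-reflexive (trans order (sym (*-identityʳ n)))))) ,
    half-difference⇐ (2 * m) (n * (δ + t * h)) (s * h * t * suc t)
      (trans (cong (λ z → 2 * (2 * m) + z) (tri-double h s t)) (trans (sym (*-distribˡ-+ 2 (2 * m) _)) (cong (2 *_) weight)))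

module _ (δ k t n m : ℕ) .{{_ : NonZero δ}} .{{_ : NonZero t}} where

  private
    h = suc k
    D≢0 : NonZero (h * t * suc t)
    D≢0 = m*n≢0 (h * t) (suc t) {{m*n≢0 h t}}

    -- Shows that σ = f_t and the equation for 2m in `Admissible` are the same linear condition, up
    -- to a factor 2.
    fold-weight : ∀ σ → σ * (h * t * suc t) + 2 * (2 * m) ≡ 2 * (2 * m + h * σ * tri t)
    fold-weight σ = begin
      σ * (h * t * suc t) + 2 * (2 * m)      ≡⟨ cong (_+ 2 * (2 * m)) (assoc σ h t) ⟩
      σ * h * t * suc t + 2 * (2 * m)        ≡⟨ cong (_+ 2 * (2 * m)) (tri-double h σ t) ⟩
      2 * (h * σ * tri t) + 2 * (2 * m)      ≡⟨ +-comm (2 * (h * σ * tri t)) _ ⟩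
      2 * (2 * m) + 2 * (h * σ * tri t)      ≡⟨ *-distribˡ-+ 2 (2 * m) _ ⟨
      2 * (2 * m + h * σ * tri t)            ∎
      where
      open ≡-Reasoning
      assoc : ∀ σ h t → σ * (h * t * suc t) ≡ σ * h * t * suc t
      assoc = solve-∀

  extremal⇒balanced : (G : Graph n) → size G ≡ m → minDegree G ≡ δ → + sp G k / 1 ≡ f t n m δ k →
                      ∃[ r ] Balanced δ h t n m (sp G k) r × degrees G ↭ stair δ h t (sp G k) r
  extremal⇒balanced G size≡ min≡ sp≡ = conclude (sum-bound-tight k σ δ t (degrees G)
      (subst (λ c → All (c ≤_) (degrees G)) min≡ (minimum-lower (degrees G))) (count≤sp G k) tight)
    where
    σ = sp G k

    weight : 2 * m + h * σ * tri t ≡ n * (δ + t * h)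
    weight = *-cancelˡ-≡ _ _ 2 (trans (sym (fold-weight σ))
      (double-quotient⇒ σ (n * (δ + t * h)) (2 * m) (h * t * suc t) {{D≢0}} sp≡))

    sum≡ : sum (degrees G) ≡ 2 * m
    sum≡ = trans (handshake G) (cong (2 *_) size≡)

    tight : sum (degrees G) + h * σ * tri t ≤ length (degrees G) * (δ + t * h)
    tight = ≤-reflexive (trans (cong (_+ h * σ * tri t) sum≡) (trans weight (cong (_* (δ + t * h)) (sym (length-degrees G)))))

    conclude : ∃[ r ] r ≤ σ × degrees G ↭ stair δ h t σ r →
               ∃[ r ] Balanced δ h t n m σ r × degrees G ↭ stair δ h t σ r
    conclude (r , r≤σ , perm) = r , balanced order r≤σ weight , perm
      where
      order : t * σ + r ≡ n
      order = trans (sym (length-stair δ h t σ r)) (trans (sym (↭-length perm)) (length-degrees G))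

  balanced⇒extremal : 2 ≤ n → ∀ {s r} → Balanced δ h t n m s r → (G : Graph n) → degrees G ↭ stair δ h t s r →
                      size G ≡ m × minDegree G ≡ δ × + sp G k / 1 ≡ f t n m δ k
  balanced⇒extremal 2≤n {s} {r} bal G perm = size≡ , min≡ t perm , sp≡f
    where
    open Balanced bal

    size≡ : size G ≡ m
    size≡ = *-cancelˡ-≡ _ _ 2 (trans (sym (handshake G)) (trans (sum-↭ perm) sum≡))

    min≡ : ∀ t .{{_ : NonZero t}} → degrees G ↭ stair δ h t s r → minDegree G ≡ δ
    min≡ (suc t) perm = minimum-unique (All-resp-↭ (↭-sym perm) (stair-≥ δ h (suc t) s r))
                         (∈-resp-↭ (↭-sym perm) (bottom∈stair {t = t} {r = r} (positive 2≤n)))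

    sp≡ : ∀ t .{{_ : NonZero t}} → degrees G ↭ stair δ h t s r → sp G k ≡ s
    sp≡ (suc t) perm = sp-stair G k δ t s r r≤s perm

    sp≡f : + sp G k / 1 ≡ f t n m δ k
    sp≡f = double-quotient⇐ (sp G k) (n * (δ + t * h)) (2 * m) (h * t * suc t) {{D≢0}}
      (subst (λ σ → σ * (h * t * suc t) + 2 * (2 * m) ≡ 2 * (n * (δ + t * h))) (sym (sp≡ t perm))
        (trans (fold-weight s) (cong (2 *_) weight)))

  extremal⇔graphic : ∀ {h} → h ≡ suc k → 2 ≤ n →
    (Σ[ G ∈ Graph n ] (size G ≡ m × minDegree G ≡ δ × + sp G k / 1 ≡ f t n m δ k)) ⇔
    (∃[ s ] (Admissible δ h t n m s × Graphic (P δ h t n s)))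
  extremal⇔graphic refl 2≤n = mk⇔ to from
    where
    to : Σ[ G ∈ Graph n ] (size G ≡ m × minDegree G ≡ δ × + sp G k / 1 ≡ f t n m δ k) →
         ∃[ s ] (Admissible δ h t n m s × Graphic (P δ h t n s))
    to (G , size≡ , min≡ , sp≡) = conclude (extremal⇒balanced G size≡ min≡ sp≡)
      where
      conclude : ∃[ r ] Balanced δ h t n m (sp G k) r × degrees G ↭ stair δ h t (sp G k) r →
                 ∃[ s ] (Admissible δ h t n m s × Graphic (P δ h t n s))
      conclude (r , bal , perm) = sp G k , admissible⇐ bal , n , G , subst (degrees G ↭_) (sym (Balanced.P≡ bal)) perm

    from : ∃[ s ] (Admissible δ h t n m s × Graphic (P δ h t n s)) →
           Σ[ G ∈ Graph n ] (size G ≡ m × minDegree G ≡ δ × + sp G k / 1 ≡ f t n m δ k)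
    from (s , adm , n′ , G′ , perm′) = restore G′ perm n′≡n
      where
      bal = admissible⇒ adm
      open Balanced bal

      perm : degrees G′ ↭ stair δ h t s (n ∸ t * s)
      perm = subst (degrees G′ ↭_) P≡ perm′

      -- `Graphic` leaves the order of the graph open; the length of P fixes it.
      n′≡n : n′ ≡ n
      n′≡n = trans (sym (length-degrees G′)) (trans (↭-length perm) length≡)

      restore : ∀ {n′} (G : Graph n′) → degrees G ↭ stair δ h t s (n ∸ t * s) → n′ ≡ n →
                Σ[ G ∈ Graph n ] (size G ≡ m × minDegree G ≡ δ × + sp G k / 1 ≡ f t n m δ k)
      restore G perm refl = G , balanced⇒extremal 2≤n bal G perm

-- With Δ = δ + th as upper bound for the terms, Δ + 1 + δ is the 2δ + th + 1 of the statement.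
long⇒graphic : ∀ {δ h t n m s r} → 1 ≤ δ → Balanced δ h t n m s r → (2 * δ + t * h + 1) ^ 2 ≤ n * (4 * δ) → Graphic (stair δ h t s r)
long⇒graphic {δ} {h} {t} {n} {m} {s} {r} 1≤δ bal long = erdősGallai⇒graphic (stair δ h t s r) m sum≡
  (erdősGallai-long δ (δ + t * h) (stair δ h t s r) 1≤δ (stair-≥ δ h t s r) (stair-≤ δ h t s r) (begin
    (suc (δ + t * h) + δ) * (suc (δ + t * h) + δ)   ≡⟨ square δ (t * h) ⟩
    (2 * δ + t * h + 1) ^ 2                         ≤⟨ long ⟩
    n * (4 * δ)                                     ≡⟨ *-comm n (4 * δ) ⟩
    4 * δ * n                                       ≡⟨ cong (4 * δ *_) length≡ ⟨
    4 * δ * length (stair δ h t s r)                ∎))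
  where
  open Balanced bal
  open ≤-Reasoning
  square : ∀ δ a → (suc (δ + a) + δ) * (suc (δ + a) + δ) ≡ (2 * δ + a + 1) * ((2 * δ + a + 1) * 1)
  square = solve-∀

maximum-mem : ∀ {x xs} → x List.∈ xs → x ≤ maximum xs
maximum-mem {xs = xs} x∈ = All.lookup (maximum-upper xs) x∈

consecutive⇒graphic : ∀ {δ h t n m s r} → h ≡ 1 → 1 ≤ δ → 1 ≤ s → Balanced δ h t n m s r →
                      maximum (stair δ h t s r) < n → Graphic (stair δ h t s r)
consecutive⇒graphic {δ} {t = t} {n} {m} {s} {r} refl 1≤δ 1≤s bal max<n =
  erdősGallai⇒graphic (stair δ 1 t s r) m sum≡ (go t r r≤s (subst (maximum (stair δ 1 t s r) <_) (sym order) max<n))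
  where
  open Balanced bal

  -- For r ≥ 1 the value δ + t occurs, so the bound on the maximum supplies the hypothesis δ + t <
  -- ts + r of `erdősGallai-stair`.
  top : ∀ t r → 1 ≤ r → r ≤ s → maximum (stair δ 1 t s r) < t * s + r → ErdősGallaiList (stair δ 1 t s r)
  top t r 1≤r r≤s max< = erdősGallai-stair 1≤δ r≤s (≤-<-trans (maximum-mem
    (subst (λ z → δ + z List.∈ stair δ 1 t s r) (*-identityʳ t) (top∈stair δ 1 t 1≤r))) max<)

  -- When r = 0 the largest term is δ + t - 1, with multiplicity s.
  go : ∀ t r → r ≤ s → maximum (stair δ 1 t s r) < t * s + r → ErdősGallaiList (stair δ 1 t s r)
  go t       (suc r) r≤s max< = top t (suc r) (s≤s z≤n) r≤s max<
  go (suc t) zero    r≤s max< = subst ErdősGallaiList (sym (stair-full δ 1 t s))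
    (top t s 1≤s ≤-refl (subst₂ (λ xs z → maximum xs < z) (stair-full δ 1 t s)
      (trans (+-identityʳ _) (+-comm s (t * s))) max<))

theorem10 : ∀ (δ k h t n m : ℕ) .{{_ : NonZero δ}} .{{_ : NonZero t}} →
    h ≡ k + 1 → 2 ≤ n → n * δ ≤ 2 * m →
    ((Σ[ G ∈ Graph n ] (size G ≡ m × minDegree G ≡ δ × + sp G k / 1 ≡ f t n m δ k))
    ⇔ (∃[ s ] (Admissible δ h t n m s × Graphic (P δ h t n s))))
    × (∀ (s : ℕ) → Admissible δ h t n m s →
    (_/_ (+ ((2 * δ + t * h + 1) ^ 2)) (4 * δ) {{m*n≢0 4 δ}} ℚ.≤ + n / 1 →
    Graphic (P δ h t n s))
    × (k ≡ 0 → (Graphic (P δ h t n s) ⇔ maximum (P δ h t n s) < n)))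
theorem10 δ k h t n m h≡ 2≤n _ = extremal⇔graphic δ k t n m (trans h≡ (+-comm k 1)) 2≤n , λ s adm →
  let bal = admissible⇒ {δ} {h} {t} {n} {m} {s} adm
      open Balanced bal
      length-P : length (P δ h t n s) ≡ n
      length-P = trans (cong length P≡) length≡
  in
  (λ le → subst Graphic (sym P≡) (long⇒graphic (>-nonZero⁻¹ δ) bal (subst (_≤ n * (4 * δ)) (*-identityʳ _)
    (cross-≤ ((2 * δ + t * h + 1) ^ 2) (4 * δ) n 1 {{m*n≢0 4 δ}} le)))) ,
  λ k≡0 → mk⇔
    (λ graphic → subst (maximum (P δ h t n s) <_) length-P
      (graphic⇒maximum< (subst (1 ≤_) (sym length-P) (<⇒≤ 2≤n)) graphic))
    (λ max<n → subst Graphic (sym P≡)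
      (consecutive⇒graphic (trans h≡ (cong (_+ 1) k≡0)) (>-nonZero⁻¹ δ) (positive 2≤n) bal
        (subst (λ xs → maximum xs < n) P≡ max<n)))
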